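{- For any admissibly ordered orthoplicial Platonic configuration $\mathscr{V}$, its $F$-matrix $\boldsymbol{F}=\boldsymbol{F}(\mathscr{V})$ satisfies $$\boldsymbol{F}^{T}\boldsymbol{Q}_F\,\boldsymbol{F}=\boldsymbol{Q}_W .$$ In particular, writing $\boldsymbol{a},\boldsymbol{b},\hat{\boldsymbol{x}},\hat{\boldsymbol{y}},\hat{\boldsymbol{z}}$ for the 1st, 2nd, 3rd, 4th, 5th column vectors of $\boldsymbol{F}$, we have $$F(\boldsymbol{a})=0,\quad F(\boldsymbol{b})=0,\quad F(\hat{\boldsymbol{x}})=2,\quad F(\hat{\boldsymbol{y}})=2,\quad F(\hat{\boldsymbol{z}})=2 .$$
   Context: Work in $\hat{\mathbb{R}}^3=\mathbb{R}^3\cup\{\infty\}$. A "sphere" $S$ means a Euclidean sphere, or a plane (with $\infty$ added), together with a choice of orienting region $B$, one of the two components of its complement. Its inversive coordinate vector $\boldsymbol{v}(S)=(a,b,\hat x,\hat y,\hat z)$ (a row vector) is: for a Euclidean sphere with center $\boldsymbol{c}$ and oriented radius $r$ ($r>0$ if $B$ is the ball, $r<0$ if $B$ is the exterior), $b=1/r$ (the bend), $a=b|\boldsymbol{c}|^2-1/b$, and $(\hat x,\hat y,\hat z)=b\,\boldsymbol{c}$; for a plane $\{\boldsymbol{n}\cdot\boldsymbol{x}=h\}$ with $\boldsymbol{n}$ the unit normal pointing into $B$, $\boldsymbol{v}(S)=(2h,0,n_x,n_y,n_z)$. Möbius transformations of $\hat{\mathbb{R}}^3$ (all conformal and anti-conformal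 transformations) act on oriented spheres by mapping $(S,B)$ to its image. The standard configuration $\mathscr{V}_0=(S_1,\dots,S_8)$ consists of the spheres with inversive coordinates $(2,0,0,0,1)$, $(2,0,0,0,-1)$, $(1,1,\sqrt2,0,0)$, $(1,1,0,\sqrt2,0)$, $(0,2,0,0,-1)$, $(0,2,0,0,1)$, $(1,1,-\sqrt2,0,0)$, $(1,1,0,-\sqrt2,0)$, in this order. An orthoplicial Platonic configuration is the image of $\mathscr{V}_0$ under a Möbius transformation. An ordering $S_1,\dots,S_8$ of its spheres is admissible if distinct $S_i,S_j$ are tangent when $i\not\equiv j\pmod 4$ and disjoint when $i\equiv j\pmod 4$. For an admissibly ordered configuration put $\boldsymbol{v}_k=\boldsymbol{v}(S_k)$ and $\boldsymbol{v}_\mu=\tfrac12(\boldsymbol{v}_1+\boldsymbol{v}_5)$ (the antipodal vector). Its $F$-matrix is the $5\times5$ matrix with rows $\boldsymbol{v}_1,\boldsymbol{v}_2,\boldsymbol{v}_3,\boldsymbol{v}_4,\boldsymbol{v}_\mu$. Matrices: $$\boldsymbol{Q}_F=\begin{pmatrix}1&0&0&0&-1\\0&1&0&0&-1\\0&0&1&0&-1\\0&0&0&1&-1\\-1&-1&-1&-1&2\end{pmatrix},\qquad \boldsymbol{Q}_W=\begin{pmatrix}0&-4&0&0&0\\-4&0&0&0&0\\0&0&2&0&0\\0&0&0&2&0\\0&0&0&0&2\end{pmatrix}.$$ The orthoplicial Descartes form is $F(\boldsymbol{\zeta})=\boldsymbol{\zeta}^T\boldsymbol{Q}_F\boldsymbol{\zeta}=2\zeta_\mu^2-2\zeta_\mu(\zeta_1+\zeta_2+\zeta_3+\zeta_4)+(\zeta_1^2+\zeta_2^2+\zeta_3^2+\zeta_4^2)$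 for $\boldsymbol{\zeta}=(\zeta_1,\zeta_2,\zeta_3,\zeta_4,\zeta_\mu)^T$. -}

module Defs where

open import Algebra.Bundles using (CommutativeRing)
open import Algebra.Definitions using (Invertible)
open import Data.Empty.Polymorphic using (⊥)
open import Data.Fin.Base using (Fin; toℕ)
open import Data.Fin.Patterns using (0F; 1F; 2F; 3F; 4F)
open import Data.Fin.Permutation using (Permutation′; _⟨$⟩ʳ_)
open import Data.List.Base using (List; foldr)
open import Data.Maybe.Base using (Maybe; just; nothing)
open import Data.Maybe.Relation.Binary.Pointwise using (Pointwise)
open import Data.Nat.Base using (ℕ)
open import Data.Nat.DivMod using (_%_)
open import Data.Product.Base using (∃; _×_; _,_; proj₁)
open import Data.Sum.Base using (_⊎_)
open import Data.Unit.Polymorphic using (⊤)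
open import Data.Vec.Functional using (Vector; _∷_; [])
open import Function.Bundles using (_⇔_)
open import Level using (Level; suc; _⊔_)
open import Relation.Binary.Core using (Rel)
import Relation.Binary.Construct.StrictToNonStrict as NonStrict
open import Relation.Binary.PropositionalEquality.Core using (_≡_; _≢_)
open import Relation.Binary.Structures using (IsStrictTotalOrder)
open import Relation.Nullary.Decidable.Core using (yes; no)
open import Relation.Nullary.Negation.Core using (¬_)
open import Relation.Unary using (Pred; Satisfiable)
import Algebra.Properties.Monoid.Sum as Sum
import Data.Vec.Functional.Relation.Binary.Equality.Setoid as VecEquality

-- The real numbers, given by the axioms of a complete ordered field, which
-- characterise them up to unique isomorphism.  The order is total in the
-- classical sense: `compare` decides trichotomy.
record Reals (c ℓ₁ ℓ₂ : Level) : Set (suc (c ⊔ ℓ₁ ⊔ ℓ₂)) where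
  field
    commutativeRing : CommutativeRing c ℓ₁

  open CommutativeRing commutativeRing public

  infix 4 _<_
  field
    _<_                : Rel Carrier ℓ₂
    isStrictTotalOrder : IsStrictTotalOrder _≈_ _<_
    0<1                : 0# < 1#
    +-monoˡ-<          : ∀ z {x y} → x < y → x + z < y + z
    *-pos              : ∀ {x y} → 0# < x → 0# < y → 0# < x * y
    invertible         : ∀ x → x ≉ 0# → Invertible _≈_ 1# _*_ x

  open IsStrictTotalOrder isStrictTotalOrder public
    using (compare; _≟_; _<?_; irrefl; <-resp-≈; <-respˡ-≈; <-respʳ-≈)
    renaming (trans to <-trans)
  open NonStrict _≈_ _<_ public using (_≤_)

  UpperBound : Pred Carrier (c ⊔ ℓ₁ ⊔ ℓ₂) → Pred Carrier (c ⊔ ℓ₁ ⊔ ℓ₂)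
  UpperBound P u = ∀ {x} → P x → x ≤ u

  field
    supremum : ∀ P → Satisfiable P → Satisfiable (UpperBound P) →
               ∃ λ s → UpperBound P s × (∀ {u} → UpperBound P u → s ≤ u)

  infix 8 _⁻¹[_]
  _⁻¹[_] : ∀ x → x ≉ 0# → Carrier
  x ⁻¹[ x≉0 ] = proj₁ (invertible x x≉0)

  2# 4# : Carrier
  2# = 1# + 1#
  4# = 2# + 2#

  0<2 : 0# < 2#
  0<2 = <-trans 0<1 (<-respˡ-≈ (+-identityˡ 1#) (+-monoˡ-< 1# 0<1))

  ½ : Carrier
  ½ = 2# ⁻¹[ (λ 2≈0 → irrefl (sym 2≈0) 0<2) ]

module Orthoplicial {c ℓ₁ ℓ₂} (ℝ : Reals c ℓ₁ ℓ₂) where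

  open Reals ℝ
  open Sum +-monoid using (sum)
  open VecEquality setoid using (_≋_)

  Matrix : ℕ → ℕ → Set c
  Matrix m n = Vector (Vector Carrier n) m

  infixl 7 _·_ _⊗_
  infix 8 _ᵀ

  _·_ : ∀ {n} → Vector Carrier n → Vector Carrier n → Carrier
  u · v = sum (λ i → u i * v i)

  _ᵀ : ∀ {m n} → Matrix m n → Matrix n m
  (A ᵀ) i j = A j i

  _⊗_ : ∀ {m n p} → Matrix m n → Matrix n p → Matrix m p
  (A ⊗ B) i j = A i · (B ᵀ) j

  column : ∀ {m n} → Matrix m n → Fin n → Vector Carrier m
  column A j = (A ᵀ) j

  infix 4 _≈ᴹ_
  _≈ᴹ_ : ∀ {m n} → Matrix m n → Matrix m n → Set ℓ₁
  A ≈ᴹ B = ∀ i → A i ≋ B i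

  ℝ³ : Set c
  ℝ³ = Vector Carrier 3

  ∣_∣² : ℝ³ → Carrier
  ∣ x ∣² = x · x

  infixl 6 _-ᵛ_
  _-ᵛ_ : ℝ³ → ℝ³ → ℝ³
  (x -ᵛ y) i = x i - y i

  -- ℝ³ ∪ {∞}, with `nothing` as ∞.
  ℝ̂³ : Set c
  ℝ̂³ = Maybe ℝ³

  infix 4 _≈̂_
  _≈̂_ : Rel ℝ̂³ (c ⊔ ℓ₁)
  _≈̂_ = Pointwise _≋_

  data OrientedSphere : Set (c ⊔ ℓ₁) where
    -- Centre and oriented radius.
    sphere : (z : ℝ³) (r : Carrier) → r ≉ 0# → OrientedSphere
    -- The plane n · x ≈ h, with n the unit normal pointing into the region.
    plane  : (n : ℝ³) (h : Carrier) → ∣ n ∣² ≈ 1# → OrientedSphere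

  surface : OrientedSphere → Pred ℝ̂³ ℓ₁
  surface (sphere z r _) (just x) = ∣ x -ᵛ z ∣² ≈ r * r
  surface (sphere _ _ _) nothing  = ⊥
  surface (plane n h _)  (just x) = n · x ≈ h
  surface (plane _ _ _)  nothing  = ⊤

  -- The orienting component of the complement of the surface.
  region : OrientedSphere → Pred ℝ̂³ ℓ₂
  region (sphere z r _) (just x) = (0# < r × ∣ x -ᵛ z ∣² < r * r)
                                 ⊎ (r < 0# × r * r < ∣ x -ᵛ z ∣²)
  region (sphere _ r _) nothing  = r < 0#
  region (plane n h _)  (just x) = h < n · x
  region (plane _ _ _)  nothing  = ⊥

  Disjoint : Rel OrientedSphere (c ⊔ ℓ₁)
  Disjoint S T = ∀ p → ¬ (surface S p × surface T p)

  -- Exactly one common point in ℝ̂³; in particular parallel planes are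
  -- tangent at ∞.
  Tangent : Rel OrientedSphere (c ⊔ ℓ₁)
  Tangent S T = ∃ λ p → surface S p × surface T p ×
                        (∀ q → surface S q → surface T q → q ≈̂ p)

  -- (a , b , x̂ , ŷ , ẑ); note that 1/b is r.
  inversiveCoordinates : OrientedSphere → Vector Carrier 5
  inversiveCoordinates (sphere z r r≉0) = b * ∣ z ∣² - r ∷ b ∷ λ i → b * z i
    where
    b : Carrier
    b = r ⁻¹[ r≉0 ]
  inversiveCoordinates (plane n h _) = 2# * h ∷ 0# ∷ n

  -- Inversion in a sphere, or Euclidean reflection in a plane (the
  -- orientation plays no role).  The centre of a sphere is recognised by
  -- ∣ x - z ∣² ≈ 0.
  reflect : OrientedSphere → ℝ̂³ → ℝ̂³
  reflect (sphere z r _) nothing  = just z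
  reflect (sphere z r _) (just x) with ∣ x -ᵛ z ∣² ≟ 0#
  ... | yes _   = nothing
  ... | no d≉0 = just λ i →
    z i + r * r * ∣ x -ᵛ z ∣² ⁻¹[ d≉0 ] * (x i - z i)
  reflect (plane n h _)  nothing  = nothing
  reflect (plane n h _)  (just x) = just λ i → x i - 2# * (n · x - h) * n i

  -- The group of all conformal and anti-conformal transformations of ℝ̂³ is
  -- generated by the inversions and reflections; each generator is an
  -- involution, so finite products suffice.
  IsMöbius : Pred (ℝ̂³ → ℝ̂³) (c ⊔ ℓ₁)
  IsMöbius f = ∃ λ (mirrors : List OrientedSphere) →
    ∀ p → f p ≈̂ foldr reflect p mirrors

  -- For a bijection f this says f(S) = T and f(B_S) = B_T as point sets.
  infix 4 _maps_to_
  _maps_to_ : (ℝ̂³ → ℝ̂³) → OrientedSphere → OrientedSphere →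
              Set (c ⊔ ℓ₁ ⊔ ℓ₂)
  f maps S to T = ∀ p → (surface S p ⇔ surface T (f p))
                      × (region S p ⇔ region T (f p))

  standardCoordinates : Carrier → Matrix 8 5
  standardCoordinates √2 =
      (2# ∷ 0# ∷ 0#   ∷ 0#   ∷ 1#   ∷ [])
    ∷ (2# ∷ 0# ∷ 0#   ∷ 0#   ∷ - 1# ∷ [])
    ∷ (1# ∷ 1# ∷ √2   ∷ 0#   ∷ 0#   ∷ [])
    ∷ (1# ∷ 1# ∷ 0#   ∷ √2   ∷ 0#   ∷ [])
    ∷ (0# ∷ 2# ∷ 0#   ∷ 0#   ∷ - 1# ∷ [])
    ∷ (0# ∷ 2# ∷ 0#   ∷ 0#   ∷ 1#   ∷ [])
    ∷ (1# ∷ 1# ∷ - √2 ∷ 0#   ∷ 0#   ∷ [])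
    ∷ (1# ∷ 1# ∷ 0#   ∷ - √2 ∷ 0#   ∷ [])
    ∷ []

  IsStandard : Pred (Vector OrientedSphere 8) (c ⊔ ℓ₁ ⊔ ℓ₂)
  IsStandard V = ∃ λ √2 → 0# < √2 × √2 * √2 ≈ 2# ×
    (∀ k → inversiveCoordinates (V k) ≋ standardCoordinates √2 k)

  -- The family W lists, in some order, the images of the spheres of the
  -- standard configuration under a Möbius transformation.
  IsOrthoplicial : Pred (Vector OrientedSphere 8) (c ⊔ ℓ₁ ⊔ ℓ₂)
  IsOrthoplicial W =
    ∃ λ V → ∃ λ f → ∃ λ (π : Permutation′ 8) →
      IsStandard V × IsMöbius f × (∀ k → f maps V k to W (π ⟨$⟩ʳ k))

  IsAdmissible : Pred (Vector OrientedSphere 8) (c ⊔ ℓ₁)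
  IsAdmissible W = ∀ i j → i ≢ j →
      (toℕ i % 4 ≢ toℕ j % 4 → Tangent  (W i) (W j))
    × (toℕ i % 4 ≡ toℕ j % 4 → Disjoint (W i) (W j))

  antipodalVector : Vector OrientedSphere 8 → Vector Carrier 5
  antipodalVector W i =
    ½ * (inversiveCoordinates (W 0F) i + inversiveCoordinates (W 4F) i)

  F-matrix : Vector OrientedSphere 8 → Matrix 5 5
  F-matrix W = inversiveCoordinates (W 0F)
             ∷ inversiveCoordinates (W 1F)
             ∷ inversiveCoordinates (W 2F)
             ∷ inversiveCoordinates (W 3F)
             ∷ antipodalVector W
             ∷ []

  Q-F : Matrix 5 5
  Q-F =
      (1#   ∷ 0#   ∷ 0#   ∷ 0#   ∷ - 1# ∷ [])
    ∷ (0#   ∷ 1#   ∷ 0#   ∷ 0#   ∷ - 1# ∷ [])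
    ∷ (0#   ∷ 0#   ∷ 1#   ∷ 0#   ∷ - 1# ∷ [])
    ∷ (0#   ∷ 0#   ∷ 0#   ∷ 1#   ∷ - 1# ∷ [])
    ∷ (- 1# ∷ - 1# ∷ - 1# ∷ - 1# ∷ 2#   ∷ [])
    ∷ []

  Q-W : Matrix 5 5
  Q-W =
      (0#   ∷ - 4# ∷ 0# ∷ 0# ∷ 0# ∷ [])
    ∷ (- 4# ∷ 0#   ∷ 0# ∷ 0# ∷ 0# ∷ [])
    ∷ (0#   ∷ 0#   ∷ 2# ∷ 0# ∷ 0# ∷ [])
    ∷ (0#   ∷ 0#   ∷ 0# ∷ 2# ∷ 0# ∷ [])
    ∷ (0#   ∷ 0#   ∷ 0# ∷ 0# ∷ 2# ∷ [])
    ∷ []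

  -- ζᵀ Q_F ζ.
  descartesForm : Vector Carrier 5 → Carrier
  descartesForm ζ = ζ · (λ i → Q-F i · ζ)

{-# OPTIONS --safe #-}

-- Inversive coordinates carry a Lorentzian form for which every sphere has the
-- same norm, and an inversion acts on them as the orthogonal reflection in the
-- coordinates of its mirror.  To see this, embed ℝ³ ∪ {∞} in the light cone:
-- incidence and side of a point become vanishing and sign of the pairing, the
-- inversion becomes the reflection up to a positive factor, and a vector of the
-- right norm is determined by its zeros and signs on the light cone.  Hence the
-- coordinates of an orthoplicial configuration are the isometric image of the
-- standard ones.  Those form a frame: their sum of squares is three times the
-- square of the antipodal sum σ plus 2 Q_W, and this sum over all eight spheres is
-- insensitive to the order.  Twice Fᵀ Q_F F is exactly that sum minus 3 σ ⊗ σ once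
-- opposite spheres add up to σ, which admissibility ensures: non-antipodal
-- standard spheres share a point, so disjoint spheres come from antipodal ones.
module Submission where

open import Defs
open import Algebra.Bundles using (CommutativeRing)
import Algebra.Solver.Ring as RingSolver
open import Algebra.Solver.Ring.AlmostCommutativeRing
  using (fromCommutativeRing; _-Raw-AlmostCommutative⟶_)
open import Data.Bool.Base using (T)
open import Data.Fin.Base using (Fin; suc; toℕ)
open import Data.Fin.Patterns using (0F; 1F; 2F; 3F; 4F; 5F; 6F; 7F)
open import Data.Fin.Permutation using (Permutation′; _⟨$⟩ʳ_; _⟨$⟩ˡ_; flip; inverseʳ)
open import Data.Fin.Properties as Fin using (all?)
open import Data.Integer.Base as ℤ using (ℤ; +_; -[1+_])
import Data.Integer.Properties as ℤ
open import Data.List.Base as List using (List; foldr)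
open import Data.Maybe using (to-witness-T)
open import Data.Maybe.Base using (Maybe; just; nothing; is-just)
open import Data.Maybe.Relation.Binary.Pointwise using (just; nothing)
open import Data.Nat.Base as ℕ using (ℕ)
open import Data.Nat.DivMod using (_%_)
import Data.Nat.Properties as ℕ
open import Data.Product.Base using (∃; _×_; _,_; proj₁; proj₂)
open import Data.Sum.Base using (inj₁; inj₂)
open import Data.Unit.Polymorphic using (tt)
open import Data.Vec.Base as Vec using (Vec)
open import Data.Vec.Functional as Vector using (Vector; _∷_; [])
import Data.Vec.Functional.Relation.Binary.Equality.Setoid as VecEquality
open import Data.Vec.N-ary using (N-ary; Eq; curryⁿ; curryⁿ-cong; _$ⁿ_)
open import Function.Base using (_∘_)
open import Function.Bundles using (module Equivalence)
open import Relation.Binary.Definitions using (tri<; tri≈; tri>)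
open import Relation.Binary.PropositionalEquality.Core as ≡ using (_≡_; _≢_)
open import Relation.Nullary.Decidable
  using (yes; no; toWitness; T?; ¬?; _→-dec_)
open import Relation.Nullary.Negation.Core using (¬_; contradiction)

-- Polynomial identities with integer coefficients.

module IntegerCoefficients {c ℓ} (R : CommutativeRing c ℓ) where

  open CommutativeRing R
  open import Algebra.Properties.AbelianGroup +-abelianGroup using (⁻¹-∙-comm)
  open import Algebra.Properties.Group +-group using (ε⁻¹≈ε; ⁻¹-involutive)
  open import Algebra.Properties.Ring ring using (-‿distribˡ-*; -‿distribʳ-*)
  open import Algebra.Properties.Semiring.Mult.TCOptimised semiring
    using (1+×; ×-homo-+; ×1-homo-*) renaming (_×_ to _×ᶜ_)
  open import Relation.Binary.Reasoning.Setoid setoid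

  -- Integer coefficients make equality of normal forms decidable by computation, which an abstract
  -- ring does not offer. With this multiple of `1#` the value of `ι (+ 1)` is `1#` by definition.
  ι : ℤ → Carrier
  ι (+ n)    = n ×ᶜ 1#
  ι -[1+ n ] = - (ℕ.suc n ×ᶜ 1#)

  ι-⊖ : ∀ m n → ι (m ℤ.⊖ n) ≈ m ×ᶜ 1# - n ×ᶜ 1#
  ι-⊖ m ℕ.zero = begin
    ι (m ℤ.⊖ 0)      ≡⟨ ≡.cong ι (ℤ.⊖-≥ {m} ℕ.z≤n) ⟩
    m ×ᶜ 1#          ≈⟨ +-identityʳ _ ⟨
    m ×ᶜ 1# + 0#     ≈⟨ +-congˡ ε⁻¹≈ε ⟨
    m ×ᶜ 1# - 0#     ∎
  ι-⊖ ℕ.zero (ℕ.suc n) = sym (+-identityˡ _)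
  ι-⊖ (ℕ.suc m) (ℕ.suc n) = begin
    ι (ℕ.suc m ℤ.⊖ ℕ.suc n)                    ≡⟨ ≡.cong ι (ℤ.[1+m]⊖[1+n]≡m⊖n m n) ⟩
    ι (m ℤ.⊖ n)                                ≈⟨ ι-⊖ m n ⟩
    m ×ᶜ 1# - n ×ᶜ 1#                          ≈⟨ +-congʳ (+-identityʳ _) ⟨
    m ×ᶜ 1# + 0# - n ×ᶜ 1#                     ≈⟨ +-congʳ (+-congˡ (-‿inverseʳ 1#)) ⟨
    m ×ᶜ 1# + (1# - 1#) - n ×ᶜ 1#              ≈⟨ +-congʳ (+-assoc _ _ _) ⟨
    m ×ᶜ 1# + 1# - 1# - n ×ᶜ 1#                ≈⟨ +-congʳ (+-congʳ (+-comm _ _)) ⟩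
    1# + m ×ᶜ 1# - 1# - n ×ᶜ 1#                ≈⟨ +-assoc _ _ _ ⟩
    1# + m ×ᶜ 1# + (- 1# - n ×ᶜ 1#)            ≈⟨ +-congˡ (⁻¹-∙-comm _ _) ⟩
    1# + m ×ᶜ 1# - (1# + n ×ᶜ 1#)              ≈⟨ +-cong (1+× m 1#) (-‿cong (1+× n 1#)) ⟨
    ℕ.suc m ×ᶜ 1# - ℕ.suc n ×ᶜ 1#              ∎

  ι-homo-+ : ∀ i j → ι (i ℤ.+ j) ≈ ι i + ι j
  ι-homo-+ (+ m)    (+ n)    = ×-homo-+ 1# m n
  ι-homo-+ (+ m)    -[1+ n ] = ι-⊖ m (ℕ.suc n)
  ι-homo-+ -[1+ m ] (+ n)    = trans (ι-⊖ n (ℕ.suc m)) (+-comm _ _)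
  ι-homo-+ -[1+ m ] -[1+ n ] = begin
    - (ℕ.suc (ℕ.suc (m ℕ.+ n)) ×ᶜ 1#)      ≡⟨ ≡.cong (λ k → - (ℕ.suc k ×ᶜ 1#)) (ℕ.+-suc m n) ⟨
    - ((ℕ.suc m ℕ.+ ℕ.suc n) ×ᶜ 1#)        ≈⟨ -‿cong (×-homo-+ 1# (ℕ.suc m) (ℕ.suc n)) ⟩
    - (ℕ.suc m ×ᶜ 1# + ℕ.suc n ×ᶜ 1#)      ≈⟨ ⁻¹-∙-comm _ _ ⟨
    - (ℕ.suc m ×ᶜ 1#) - ℕ.suc n ×ᶜ 1#      ∎

  ι-homo-neg : ∀ i → ι (ℤ.- i) ≈ - ι i
  ι-homo-neg (+ ℕ.zero)  = sym ε⁻¹≈ε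
  ι-homo-neg (+ ℕ.suc n) = refl
  ι-homo-neg -[1+ n ]    = sym (⁻¹-involutive _)

  ι-homo-pos-* : ∀ m j → ι (+ m ℤ.* j) ≈ ι (+ m) * ι j
  ι-homo-pos-* m (+ n) = begin
    ι (+ m ℤ.* + n)           ≡⟨ ≡.cong ι (ℤ.pos-* m n) ⟨
    (m ℕ.* n) ×ᶜ 1#           ≈⟨ ×1-homo-* m n ⟩
    (m ×ᶜ 1#) * (n ×ᶜ 1#)     ∎
  ι-homo-pos-* m -[1+ n ] = begin
    ι (+ m ℤ.* ℤ.- (+ ℕ.suc n))    ≡⟨ ≡.cong ι (ℤ.neg-distribʳ-* (+ m) (+ ℕ.suc n)) ⟨
    ι (ℤ.- (+ m ℤ.* + ℕ.suc n))    ≈⟨ ι-homo-neg (+ m ℤ.* + ℕ.suc n) ⟩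
    - ι (+ m ℤ.* + ℕ.suc n)        ≈⟨ -‿cong (ι-homo-pos-* m (+ ℕ.suc n)) ⟩
    - (ι (+ m) * ι (+ ℕ.suc n))    ≈⟨ -‿distribʳ-* _ _ ⟩
    ι (+ m) * ι -[1+ n ]           ∎

  ι-homo-* : ∀ i j → ι (i ℤ.* j) ≈ ι i * ι j
  ι-homo-* (+ m)    j = ι-homo-pos-* m j
  ι-homo-* -[1+ m ] j = begin
    ι (ℤ.- (+ ℕ.suc m) ℤ.* j)    ≡⟨ ≡.cong ι (ℤ.neg-distribˡ-* (+ ℕ.suc m) j) ⟨
    ι (ℤ.- (+ ℕ.suc m ℤ.* j))    ≈⟨ ι-homo-neg (+ ℕ.suc m ℤ.* j) ⟩
    - ι (+ ℕ.suc m ℤ.* j)        ≈⟨ -‿cong (ι-homo-pos-* (ℕ.suc m) j) ⟩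
    - (ι (+ ℕ.suc m) * ι j)      ≈⟨ -‿distribˡ-* _ _ ⟩
    ι -[1+ m ] * ι j             ∎

  ι-morphism : ℤ.+-*-rawRing -Raw-AlmostCommutative⟶ fromCommutativeRing R
  ι-morphism = record
    { ⟦_⟧    = ι
    ; +-homo = ι-homo-+
    ; *-homo = ι-homo-*
    ; -‿homo = ι-homo-neg
    ; 0-homo = refl
    ; 1-homo = refl
    }

  _ι≟_ : ∀ i j → Maybe (ι i ≈ ι j)
  i ι≟ j with i ℤ.≟ j
  ... | yes i≡j = just (reflexive (≡.cong ι i≡j))
  ... | no  _   = nothing

  open RingSolver ℤ.+-*-rawRing (fromCommutativeRing R) ι-morphism _ι≟_ public
    using (Polynomial; con; var; _:+_; _:*_; _:-_; :-_; ⟦_⟧; normalise; _≟N_; ⟦_⟧N-cong; prove)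

  infix 4 _:=_
  _:=_ : ∀ {n} → Polynomial n → Polynomial n → Polynomial n × Polynomial n
  _:=_ = _,_

  -- A type that computes to the unit type when a closed identity is valid, so its proof can be
  -- inferred for a single identity or decided for a finite family.
  SameNormalForm : ∀ {n} → Polynomial n → Polynomial n → Set
  SameNormalForm e₁ e₂ = T (is-just (normalise e₁ ≟N normalise e₂))

  normalForm-sound : ∀ {n} (ρ : Vec Carrier n) e₁ e₂ → SameNormalForm e₁ e₂ →
                     ⟦ e₁ ⟧ ρ ≈ ⟦ e₂ ⟧ ρ
  normalForm-sound ρ e₁ e₂ same =
    prove ρ e₁ e₂ (⟦ to-witness-T (normalise e₁ ≟N normalise e₂) same ⟧N-cong ρ)

  close : ∀ {a} {A : Set a} n → N-ary n (Polynomial n) A → A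
  close n f = f $ⁿ Vec.map var (Vec.allFin n)

  -- Unlike the library's solve, this compares the normal forms by a closed
  -- computation instead of by conversion of their values in the ring.
  solve : ∀ n (f : N-ary n (Polynomial n) (Polynomial n × Polynomial n)) →
          let (e₁ , e₂) = close n f in
          {same : SameNormalForm e₁ e₂} →
          Eq n _≈_ (curryⁿ ⟦ e₁ ⟧) (curryⁿ ⟦ e₂ ⟧)
  solve n f {same} =
    let (e₁ , e₂) = close n f in
    curryⁿ-cong _≈_ ⟦ e₁ ⟧ ⟦ e₂ ⟧ (λ ρ → normalForm-sound ρ e₁ e₂ same)

  infixl 8 _:·_
  _:·_ : ∀ {n k} → Vector (Polynomial n) k → Vector (Polynomial n) k → Polynomial n
  p :· q = Vector.foldr _:+_ (con (+ 0)) (λ i → p i :* q i)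

  -- Written as sums so that the values are `2#` and `4#` by definition and solved identities fit
  -- the goals as they stand.
  :1 :2 :4 : ∀ {n} → Polynomial n
  :1 = con (+ 1)
  :2 = :1 :+ :1
  :4 = :2 :+ :2

-- Arithmetic in an ordered field.

module OrderedField {c ℓ₁ ℓ₂} (ℝ : Reals c ℓ₁ ℓ₂) where

  open Reals ℝ
  open Orthoplicial ℝ using (_·_)
  open IntegerCoefficients commutativeRing public
  open import Algebra.Properties.Monoid.Sum +-monoid
    using (sum; sum-cong-≋; sum-replicate-zero) public
  open import Relation.Binary.Reasoning.Setoid setoid

  x≈y⇒x-y≈0 : ∀ {x y} → x ≈ y → x - y ≈ 0#
  x≈y⇒x-y≈0 {x} {y} x≈y = begin
    x - y ≈⟨ +-congʳ x≈y ⟩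
    y - y ≈⟨ -‿inverseʳ y ⟩
    0#    ∎

  x-y≈0⇒x≈y : ∀ {x y} → x - y ≈ 0# → x ≈ y
  x-y≈0⇒x≈y {x} {y} x-y≈0 = begin
    x           ≈⟨ solve 2 (λ x y → x := x :- y :+ y) x y ⟩
    x - y + y   ≈⟨ +-congʳ x-y≈0 ⟩
    0# + y      ≈⟨ +-identityˡ y ⟩
    y           ∎

  -- Serves for identities that hold only under a relation `p ≈ q`: the solver checks a plain
  -- polynomial identity in which the cofactor `c` is explicit. Nesting handles several relations at
  -- once.
  modulo : ∀ {x y p q} c → p ≈ q → x ≈ y + c * (p - q) → x ≈ y
  modulo {x} {y} {p} {q} c p≈q x≈ = begin
    x                  ≈⟨ x≈ ⟩
    y + c * (p - q)    ≈⟨ +-congˡ (*-congˡ (x≈y⇒x-y≈0 p≈q)) ⟩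
    y + c * 0#         ≈⟨ +-congˡ (zeroʳ c) ⟩
    y + 0#             ≈⟨ +-identityʳ y ⟩
    y                  ∎

  -x≈0⇒x≈0 : ∀ {x} → - x ≈ 0# → x ≈ 0#
  -x≈0⇒x≈0 {x} -x≈0 = begin
    x       ≈⟨ solve 1 (λ x → x := con (+ 0) :- :- x) x ⟩
    0# - - x ≈⟨ x≈y⇒x-y≈0 (sym -x≈0) ⟩
    0#      ∎

  1≉0 : 1# ≉ 0#
  1≉0 1≈0 = irrefl (sym 1≈0) 0<1

  2≉0 : 2# ≉ 0#
  2≉0 2≈0 = irrefl (sym 2≈0) 0<2

  <-asym : ∀ {x y} → x < y → y < x → ∀ {a} {A : Set a} → A
  <-asym x<y y<x = contradiction (<-trans x<y y<x) (irrefl refl)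

  ⁻¹-inverseˡ : ∀ x x≉0 → x ⁻¹[ x≉0 ] * x ≈ 1#
  ⁻¹-inverseˡ x x≉0 = proj₁ (proj₂ (invertible x x≉0))

  ⁻¹-inverseʳ : ∀ x x≉0 → x * x ⁻¹[ x≉0 ] ≈ 1#
  ⁻¹-inverseʳ x x≉0 = proj₂ (proj₂ (invertible x x≉0))

  ⁻¹-nonzero : ∀ {x} x≉0 → x ⁻¹[ x≉0 ] ≉ 0#
  ⁻¹-nonzero {x} x≉0 x⁻¹≈0 =
    1≉0 (trans (sym (⁻¹-inverseʳ x x≉0)) (trans (*-congˡ x⁻¹≈0) (zeroʳ x)))

  *-cancelˡ-0 : ∀ {x y} → x ≉ 0# → x * y ≈ 0# → y ≈ 0#
  *-cancelˡ-0 {x} {y} x≉0 xy≈0 = begin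
    y                         ≈⟨ *-identityˡ y ⟨
    1# * y                    ≈⟨ *-congʳ (⁻¹-inverseˡ x x≉0) ⟨
    x ⁻¹[ x≉0 ] * x * y       ≈⟨ *-assoc _ x y ⟩
    x ⁻¹[ x≉0 ] * (x * y)     ≈⟨ *-congˡ xy≈0 ⟩
    x ⁻¹[ x≉0 ] * 0#          ≈⟨ zeroʳ _ ⟩
    0#                        ∎

  *-cancelˡ : ∀ {x y z} → x ≉ 0# → x * y ≈ x * z → y ≈ z
  *-cancelˡ {x} {y} {z} x≉0 xy≈xz = x-y≈0⇒x≈y (*-cancelˡ-0 x≉0 (begin
    x * (y - z)      ≈⟨ solve 3 (λ x y z → x :* (y :- z) := x :* y :- x :* z) x y z ⟩
    x * y - x * z    ≈⟨ x≈y⇒x-y≈0 xy≈xz ⟩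
    0#               ∎))

  x<y⇒x-y<0 : ∀ {x y} → x < y → x - y < 0#
  x<y⇒x-y<0 {x} {y} x<y = <-respʳ-≈ (-‿inverseʳ y) (+-monoˡ-< (- y) x<y)

  x<y⇒0<y-x : ∀ {x y} → x < y → 0# < y - x
  x<y⇒0<y-x {x} {y} x<y = <-respˡ-≈ (-‿inverseʳ x) (+-monoˡ-< (- x) x<y)

  0<-x⇒x<0 : ∀ {x} → 0# < - x → x < 0#
  0<-x⇒x<0 {x} 0<-x =
    <-respʳ-≈ (-‿inverseˡ x) (<-respˡ-≈ (+-identityˡ x) (+-monoˡ-< x 0<-x))

  x<0⇒0<-x : ∀ {x} → x < 0# → 0# < - x
  x<0⇒0<-x x<0 = <-respʳ-≈ (+-identityˡ _) (x<y⇒0<y-x x<0)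

  pos*neg : ∀ {x y} → 0# < x → y < 0# → x * y < 0#
  pos*neg {x} {y} 0<x y<0 = 0<-x⇒x<0 (<-respʳ-≈
    (solve 2 (λ x y → x :* :- y := :- (x :* y)) x y) (*-pos 0<x (x<0⇒0<-x y<0)))

  neg*neg : ∀ {x y} → x < 0# → y < 0# → 0# < x * y
  neg*neg {x} {y} x<0 y<0 = <-respʳ-≈
    (solve 2 (λ x y → :- x :* :- y := x :* y) x y) (*-pos (x<0⇒0<-x x<0) (x<0⇒0<-x y<0))

  x≉0⇒0<x*x : ∀ {x} → x ≉ 0# → 0# < x * x
  x≉0⇒0<x*x {x} x≉0 with compare x 0#
  ... | tri< x<0 _ _ = neg*neg x<0 x<0
  ... | tri≈ _ x≈0 _ = contradiction x≈0 x≉0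
  ... | tri> _ _ 0<x = *-pos 0<x 0<x

  ⁻¹-pos : ∀ {x} x≉0 → 0# < x → 0# < x ⁻¹[ x≉0 ]
  ⁻¹-pos {x} x≉0 0<x with compare (x ⁻¹[ x≉0 ]) 0#
  ... | tri< x⁻¹<0 _ _ = <-asym 0<1 (<-respˡ-≈ (⁻¹-inverseʳ x x≉0) (pos*neg 0<x x⁻¹<0))
  ... | tri≈ _ x⁻¹≈0 _ = contradiction x⁻¹≈0 (⁻¹-nonzero x≉0)
  ... | tri> _ _ 0<x⁻¹ = 0<x⁻¹

  ⁻¹-neg : ∀ {x} x≉0 → x < 0# → x ⁻¹[ x≉0 ] < 0#
  ⁻¹-neg {x} x≉0 x<0 with compare (x ⁻¹[ x≉0 ]) 0#
  ... | tri< x⁻¹<0 _ _ = x⁻¹<0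
  ... | tri≈ _ x⁻¹≈0 _ = contradiction x⁻¹≈0 (⁻¹-nonzero x≉0)
  ... | tri> _ _ 0<x⁻¹ = <-asym 0<1
    (<-respˡ-≈ (⁻¹-inverseˡ x x≉0) (pos*neg 0<x⁻¹ x<0))

  0≤x*x : ∀ x → 0# ≤ x * x
  0≤x*x x with x ≟ 0#
  ... | yes x≈0 = inj₂ (sym (trans (*-congˡ x≈0) (zeroʳ x)))
  ... | no  x≉0 = inj₁ (x≉0⇒0<x*x x≉0)

  +-pos-nonneg : ∀ {x y} → 0# < x → 0# ≤ y → 0# < x + y
  +-pos-nonneg {x} {y} 0<x (inj₁ 0<y) =
    <-trans 0<y (<-respˡ-≈ (+-identityˡ y) (+-monoˡ-< y 0<x))
  +-pos-nonneg {x} {y} 0<x (inj₂ 0≈y) =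
    <-respʳ-≈ (trans (sym (+-identityʳ x)) (+-congˡ 0≈y)) 0<x

  +-nonneg : ∀ {x y} → 0# ≤ x → 0# ≤ y → 0# ≤ x + y
  +-nonneg (inj₁ 0<x) 0≤y        = inj₁ (+-pos-nonneg 0<x 0≤y)
  +-nonneg (inj₂ 0≈x) (inj₁ 0<y) =
    inj₁ (<-respʳ-≈ (+-comm _ _) (+-pos-nonneg 0<y (inj₂ 0≈x)))
  +-nonneg (inj₂ 0≈x) (inj₂ 0≈y) = inj₂ (trans (sym (+-identityʳ 0#)) (+-cong 0≈x 0≈y))

  nonneg-sum≈0 : ∀ {x y} → 0# ≤ x → 0# ≤ y → x + y ≈ 0# → x ≈ 0# × y ≈ 0#
  nonneg-sum≈0 (inj₁ 0<x) 0≤y x+y≈0 = contradiction (+-pos-nonneg 0<x 0≤y) (irrefl (sym x+y≈0))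
  nonneg-sum≈0 {x} {y} (inj₂ 0≈x) 0≤y x+y≈0 =
    sym 0≈x , trans (sym (+-identityˡ y)) (trans (+-congʳ 0≈x) x+y≈0)

  x*x≈0⇒x≈0 : ∀ {x} → x * x ≈ 0# → x ≈ 0#
  x*x≈0⇒x≈0 {x} xx≈0 with x ≟ 0#
  ... | yes x≈0 = x≈0
  ... | no  x≉0 = *-cancelˡ-0 x≉0 xx≈0

  0≤u·u : ∀ {n} (u : Vector Carrier n) → 0# ≤ u · u
  0≤u·u {ℕ.zero}  u = inj₂ refl
  0≤u·u {ℕ.suc n} u = +-nonneg (0≤x*x (u 0F)) (0≤u·u (u ∘ suc))

  u·u≈0⇒u≈0 : ∀ {n} (u : Vector Carrier n) → u · u ≈ 0# → ∀ i → u i ≈ 0#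
  u·u≈0⇒u≈0 u u·u≈0 0F =
    x*x≈0⇒x≈0 (proj₁ (nonneg-sum≈0 (0≤x*x (u 0F)) (0≤u·u (u ∘ suc)) u·u≈0))
  u·u≈0⇒u≈0 u u·u≈0 (suc i) =
    u·u≈0⇒u≈0 (u ∘ suc) (proj₂ (nonneg-sum≈0 (0≤x*x (u 0F)) (0≤u·u (u ∘ suc)) u·u≈0)) i


  axis : ∀ {n} → Fin n → Vector Carrier n
  axis 0F      = 1# ∷ λ _ → 0#
  axis (suc i) = 0# ∷ axis i

  ·-axis : ∀ {n} (u : Vector Carrier n) i → u · axis i ≈ u i
  ·-axis {ℕ.suc n} u 0F = begin
    u 0F * 1# + (u ∘ suc) · (λ _ → 0#)   ≈⟨ +-cong (*-identityʳ (u 0F)) (sum-cong-≋ (λ i → zeroʳ (u (suc i)))) ⟩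
    u 0F + sum {n} (λ _ → 0#)            ≈⟨ +-congˡ (sum-replicate-zero n) ⟩
    u 0F + 0#                            ≈⟨ +-identityʳ (u 0F) ⟩
    u 0F                                 ∎
  ·-axis u (suc i) = begin
    u 0F * 0# + (u ∘ suc) · axis i    ≈⟨ +-cong (zeroʳ (u 0F)) (·-axis (u ∘ suc) i) ⟩
    0# + u (suc i)                    ≈⟨ +-identityˡ _ ⟩
    u (suc i)                         ∎

  axis-unit : ∀ {n} (i : Fin n) → axis i · axis i ≈ 1#
  axis-unit i = trans (·-axis (axis i) i) (reflexive (diagonal i))
    where
    diagonal : ∀ {n} (i : Fin n) → axis i i ≡ 1#
    diagonal 0F      = ≡.refl
    diagonal (suc i) = diagonal i

-- The Lorentzian form, spheres and points.

module InversiveGeometry {c ℓ₁ ℓ₂} (ℝ : Reals c ℓ₁ ℓ₂) where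

  open Reals ℝ
  open Orthoplicial ℝ
  open OrderedField ℝ public
  open VecEquality setoid using (_≋_)
  open import Relation.Binary.Reasoning.Setoid setoid

  bend : Vector Carrier 5 → Carrier
  bend v = v 1F

  space : ∀ {a} {A : Set a} → Vector A 5 → Vector A 3
  space v i = v (suc (suc i))

  -- With this normalisation ⟪ v , v ⟫ ≈ - 2# for the coordinates v of a sphere.
  ⟪_,_⟫ : Vector Carrier 5 → Vector Carrier 5 → Carrier
  ⟪ v , w ⟫ = v 0F * w 1F + v 1F * w 0F - 2# * (space v · space w)

  :⟪_,_⟫ : ∀ {n} → Vector (Polynomial n) 5 → Vector (Polynomial n) 5 → Polynomial n
  :⟪ v , w ⟫ = v 0F :* w 1F :+ v 1F :* w 0F :- :2 :* (space v :· space w)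

  ⟪⟫-comm : ∀ v w → ⟪ v , w ⟫ ≈ ⟪ w , v ⟫
  ⟪⟫-comm v w = solve 10 (λ v₀ v₁ v₂ v₃ v₄ w₀ w₁ w₂ w₃ w₄ →
    let V = v₀ ∷ v₁ ∷ v₂ ∷ v₃ ∷ v₄ ∷ []
        W = w₀ ∷ w₁ ∷ w₂ ∷ w₃ ∷ w₄ ∷ []
    in :⟪ V , W ⟫ := :⟪ W , V ⟫)
    (v 0F) (v 1F) (v 2F) (v 3F) (v 4F) (w 0F) (w 1F) (w 2F) (w 3F) (w 4F)

  ⟪⟫-linearʳ : ∀ u v k w → ⟪ u , (λ i → v i + k * w i) ⟫ ≈ ⟪ u , v ⟫ + k * ⟪ u , w ⟫
  ⟪⟫-linearʳ u v k w = solve 16 (λ u₀ u₁ u₂ u₃ u₄ v₀ v₁ v₂ v₃ v₄ k w₀ w₁ w₂ w₃ w₄ →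
    let U = u₀ ∷ u₁ ∷ u₂ ∷ u₃ ∷ u₄ ∷ []
        V = v₀ ∷ v₁ ∷ v₂ ∷ v₃ ∷ v₄ ∷ []
        W = w₀ ∷ w₁ ∷ w₂ ∷ w₃ ∷ w₄ ∷ []
    in :⟪ U , (λ i → V i :+ k :* W i) ⟫ := :⟪ U , V ⟫ :+ k :* :⟪ U , W ⟫)
    (u 0F) (u 1F) (u 2F) (u 3F) (u 4F) (v 0F) (v 1F) (v 2F) (v 3F) (v 4F)
    k (w 0F) (w 1F) (w 2F) (w 3F) (w 4F)

  ⟪⟫-homoʳ : ∀ u k w → ⟪ u , (λ i → k * w i) ⟫ ≈ k * ⟪ u , w ⟫
  ⟪⟫-homoʳ u k w = solve 11 (λ u₀ u₁ u₂ u₃ u₄ k w₀ w₁ w₂ w₃ w₄ →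
    let U = u₀ ∷ u₁ ∷ u₂ ∷ u₃ ∷ u₄ ∷ []
        W = w₀ ∷ w₁ ∷ w₂ ∷ w₃ ∷ w₄ ∷ []
    in :⟪ U , (λ i → k :* W i) ⟫ := k :* :⟪ U , W ⟫)
    (u 0F) (u 1F) (u 2F) (u 3F) (u 4F) k (w 0F) (w 1F) (w 2F) (w 3F) (w 4F)

  ⟪⟫-cong : ∀ {v v′ w w′} → v ≋ v′ → w ≋ w′ → ⟪ v , w ⟫ ≈ ⟪ v′ , w′ ⟫
  ⟪⟫-cong v≋ w≋ = +-cong
    (+-cong (*-cong (v≋ 0F) (w≋ 1F)) (*-cong (v≋ 1F) (w≋ 0F)))
    (-‿cong (*-congˡ (sum-cong-≋ (λ i → *-cong (v≋ (suc (suc i))) (w≋ (suc (suc i)))))))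

  -- The orthogonal reflection `v - 2 (⟪ v , m ⟫ / ⟪ m , m ⟫) m`, with the norm `- 2#` of a sphere's
  -- coordinates already substituted for `⟪ m , m ⟫`.
  mirror : Vector Carrier 5 → Vector Carrier 5 → Vector Carrier 5
  mirror m v i = v i + ⟪ v , m ⟫ * m i

  -- Both sides expand to `⟪ v , w ⟫ + ⟪ v , m ⟫ * ⟪ w , m ⟫`. This is what moves a reflection from
  -- a point to a sphere.
  mirror-selfAdjoint : ∀ m v w → ⟪ mirror m v , w ⟫ ≈ ⟪ v , mirror m w ⟫
  mirror-selfAdjoint m v w = begin
    ⟪ mirror m v , w ⟫                     ≈⟨ ⟪⟫-comm (mirror m v) w ⟩
    ⟪ w , mirror m v ⟫                     ≈⟨ ⟪⟫-linearʳ w v ⟪ v , m ⟫ m ⟩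
    ⟪ w , v ⟫ + ⟪ v , m ⟫ * ⟪ w , m ⟫      ≈⟨ +-cong (⟪⟫-comm w v) (*-comm _ _) ⟩
    ⟪ v , w ⟫ + ⟪ w , m ⟫ * ⟪ v , m ⟫      ≈⟨ ⟪⟫-linearʳ v w ⟪ w , m ⟫ m ⟨
    ⟪ v , mirror m w ⟫                     ∎

  mirror-involutive : ∀ m v → ⟪ m , m ⟫ ≈ - 2# → mirror m (mirror m v) ≋ v
  mirror-involutive m v mm≈-2 i = begin
    v i + ⟪ v , m ⟫ * m i + ⟪ mirror m v , m ⟫ * m i
      ≈⟨ +-congˡ (*-congʳ (trans (mirror-selfAdjoint m v m) (⟪⟫-linearʳ v m ⟪ m , m ⟫ m))) ⟩
    v i + ⟪ v , m ⟫ * m i + (⟪ v , m ⟫ + ⟪ m , m ⟫ * ⟪ v , m ⟫) * m i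
      ≈⟨ modulo (⟪ v , m ⟫ * m i) mm≈-2
           (solve 4 (λ vᵢ mᵢ vm mm → vᵢ :+ vm :* mᵢ :+ (vm :+ mm :* vm) :* mᵢ
              := vᵢ :+ vm :* mᵢ :* (mm :- :- :2)) (v i) (m i) ⟪ v , m ⟫ ⟪ m , m ⟫) ⟩
    v i ∎

  -- A self-adjoint involution preserves the form.
  mirror-isometry : ∀ m v w → ⟪ m , m ⟫ ≈ - 2# → ⟪ mirror m v , mirror m w ⟫ ≈ ⟪ v , w ⟫
  mirror-isometry m v w mm≈-2 = begin
    ⟪ mirror m v , mirror m w ⟫     ≈⟨ mirror-selfAdjoint m v (mirror m w) ⟩
    ⟪ v , mirror m (mirror m w) ⟫   ≈⟨ ⟪⟫-cong {v} (λ _ → refl) (mirror-involutive m w mm≈-2) ⟩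
    ⟪ v , w ⟫                       ∎

  -- The light-cone embedding of ℝ³ ∪ {∞}.
  lift : ℝ̂³ → Vector Carrier 5
  lift (just x) = ∣ x ∣² ∷ 1# ∷ x
  lift nothing  = 1# ∷ 0# ∷ λ _ → 0#

  lift-cong : ∀ {p q} → p ≈̂ q → lift p ≋ lift q
  lift-cong (just x≋y) 0F            = sum-cong-≋ (λ i → *-cong (x≋y i) (x≋y i))
  lift-cong (just x≋y) 1F            = refl
  lift-cong (just x≋y) (suc (suc i)) = x≋y i
  lift-cong nothing    i             = refl

  -- The form reduces to `- 2 b r` for a sphere and to `- 2 ∣ n ∣²` for a plane.
  coordinates-norm : ∀ S → ⟪ inversiveCoordinates S , inversiveCoordinates S ⟫ ≈ - 2#
  coordinates-norm (sphere z r r≉0) =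
    modulo (- 2#) (⁻¹-inverseˡ r r≉0) (solve 5 (λ b r z₀ z₁ z₂ →
      let Z = z₀ ∷ z₁ ∷ z₂ ∷ []
          V = b :* (Z :· Z) :- r ∷ b ∷ λ i → b :* Z i
      in :⟪ V , V ⟫ := :- :2 :+ :- :2 :* (b :* r :- :1))
      (r ⁻¹[ r≉0 ]) r (z 0F) (z 1F) (z 2F))
  coordinates-norm (plane n h n·n≈1) =
    modulo (- 2#) n·n≈1 (solve 4 (λ h n₀ n₁ n₂ →
      let N = n₀ ∷ n₁ ∷ n₂ ∷ []
          V = :2 :* h ∷ con (+ 0) ∷ N
      in :⟪ V , V ⟫ := :- :2 :+ :- :2 :* (N :· N :- :1))
      h (n 0F) (n 1F) (n 2F))

  -- The value is the power of `x` with respect to the sphere, divided by the oriented radius.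
  sphere-lift : ∀ z r r≉0 x → ⟪ inversiveCoordinates (sphere z r r≉0) , lift (just x) ⟫
                            ≈ r ⁻¹[ r≉0 ] * ∣ x -ᵛ z ∣² - r
  sphere-lift z r r≉0 x = solve 8 (λ b r z₀ z₁ z₂ x₀ x₁ x₂ →
    let Z = z₀ ∷ z₁ ∷ z₂ ∷ []
        X = x₀ ∷ x₁ ∷ x₂ ∷ []
        V = b :* (Z :· Z) :- r ∷ b ∷ λ i → b :* Z i
        D = λ i → X i :- Z i
    in :⟪ V , X :· X ∷ :1 ∷ X ⟫ := b :* (D :· D) :- r)
    (r ⁻¹[ r≉0 ]) r (z 0F) (z 1F) (z 2F) (x 0F) (x 1F) (x 2F)

  plane-lift : ∀ n h n·n≈1 x → ⟪ inversiveCoordinates (plane n h n·n≈1) , lift (just x) ⟫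
                             ≈ 2# * (h - n · x)
  plane-lift n h n·n≈1 x = solve 7 (λ h n₀ n₁ n₂ x₀ x₁ x₂ →
    let N = n₀ ∷ n₁ ∷ n₂ ∷ []
        X = x₀ ∷ x₁ ∷ x₂ ∷ []
        V = :2 :* h ∷ con (+ 0) ∷ N
    in :⟪ V , X :· X ∷ :1 ∷ X ⟫ := :2 :* (h :- N :· X))
    h (n 0F) (n 1F) (n 2F) (x 0F) (x 1F) (x 2F)

  ∞-lift : ∀ v → ⟪ v , lift nothing ⟫ ≈ bend v
  ∞-lift v = solve 5 (λ v₀ v₁ v₂ v₃ v₄ →
    :⟪ v₀ ∷ v₁ ∷ v₂ ∷ v₃ ∷ v₄ ∷ [] , :1 ∷ con (+ 0) ∷ (λ _ → con (+ 0)) ⟫ := v₁)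
    (v 0F) (v 1F) (v 2F) (v 3F) (v 4F)

  surface⇒≈0 : ∀ S p → surface S p → ⟪ inversiveCoordinates S , lift p ⟫ ≈ 0#
  surface⇒≈0 S@(sphere z r r≉0) (just x) on = begin
    ⟪ inversiveCoordinates S , lift (just x) ⟫            ≈⟨ sphere-lift z r r≉0 x ⟩
    r ⁻¹[ r≉0 ] * ∣ x -ᵛ z ∣² - r    ≈⟨ +-congʳ (*-congˡ on) ⟩
    r ⁻¹[ r≉0 ] * (r * r) - r        ≈⟨ modulo r (⁻¹-inverseˡ r r≉0)
      (solve 2 (λ b r → b :* (r :* r) :- r := con (+ 0) :+ r :* (b :* r :- :1)) _ r) ⟩
    0#                               ∎
  surface⇒≈0 S@(plane n h n·n≈1) (just x) on = begin
    ⟪ inversiveCoordinates S , lift (just x) ⟫   ≈⟨ plane-lift n h n·n≈1 x ⟩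
    2# * (h - n · x)        ≈⟨ *-congˡ (x≈y⇒x-y≈0 (sym on)) ⟩
    2# * 0#                 ≈⟨ zeroʳ 2# ⟩
    0#                      ∎
  surface⇒≈0 S@(plane _ _ _) nothing _ = ∞-lift (inversiveCoordinates S)

  ≈0⇒surface : ∀ S p → ⟪ inversiveCoordinates S , lift p ⟫ ≈ 0# → surface S p
  ≈0⇒surface (sphere z r r≉0) (just x) v≈0 = begin
    ∣ x -ᵛ z ∣²                                        ≈⟨ modulo (- ∣ x -ᵛ z ∣²) (⁻¹-inverseˡ r r≉0)
      (solve 3 (λ b r d → d := r :* (b :* d :- r) :+ r :* r :+ :- d :* (b :* r :- :1)) _ r _) ⟩
    r * (r ⁻¹[ r≉0 ] * ∣ x -ᵛ z ∣² - r) + r * r        ≈⟨ +-congʳ (*-congˡ (trans (sym (sphere-lift z r r≉0 x)) v≈0)) ⟩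
    r * 0# + r * r                                     ≈⟨ trans (+-congʳ (zeroʳ r)) (+-identityˡ _) ⟩
    r * r                                              ∎
  ≈0⇒surface S@(sphere z r r≉0) nothing v≈0 =
    contradiction (trans (sym (∞-lift (inversiveCoordinates S))) v≈0) (⁻¹-nonzero r≉0)
  ≈0⇒surface (plane n h n·n≈1) (just x) v≈0 =
    sym (x-y≈0⇒x≈y (*-cancelˡ-0 2≉0 (trans (sym (plane-lift n h n·n≈1 x)) v≈0)))
  ≈0⇒surface (plane n h n·n≈1) nothing _ = tt

  -- Dividing the power of the point by the oriented radius makes the sign the same for balls and
  -- exteriors: the power and `r` have opposite signs in the region. At ∞ the pairing is the bend,
  -- negative exactly for exteriors.
  region⇒<0 : ∀ S p → region S p → ⟪ inversiveCoordinates S , lift p ⟫ < 0#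
  region⇒<0 (sphere z r r≉0) (just x) = <-respˡ-≈ (sym v≈) ∘ negative
    where
    d = ∣ x -ᵛ z ∣²
    b = r ⁻¹[ r≉0 ]

    v≈ : ⟪ inversiveCoordinates (sphere z r r≉0) , lift (just x) ⟫ ≈ b * (d - r * r)
    v≈ = trans (sphere-lift z r r≉0 x) (modulo r (⁻¹-inverseˡ r r≉0)
      (solve 3 (λ b r d → b :* d :- r := b :* (d :- r :* r) :+ r :* (b :* r :- :1)) b r d))

    negative : region (sphere z r r≉0) (just x) → b * (d - r * r) < 0#
    negative (inj₁ (0<r , d<rr)) = pos*neg (⁻¹-pos r≉0 0<r) (x<y⇒x-y<0 d<rr)
    negative (inj₂ (r<0 , rr<d)) =
      <-respˡ-≈ (*-comm _ _) (pos*neg (x<y⇒0<y-x rr<d) (⁻¹-neg r≉0 r<0))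
  region⇒<0 S@(sphere z r r≉0) nothing r<0 =
    <-respˡ-≈ (sym (∞-lift (inversiveCoordinates S))) (⁻¹-neg r≉0 r<0)
  region⇒<0 (plane n h n·n≈1) (just x) h<n·x =
    <-respˡ-≈ (sym (plane-lift n h n·n≈1 x)) (pos*neg 0<2 (x<y⇒x-y<0 h<n·x))


  -- Inversions as Lorentzian reflections.

  dilation-norm : ∀ (z x : ℝ³) k → ∣ (λ i → z i + k * (x i - z i)) ∣²
                ≈ ∣ z ∣² + k * (2# * (z · (x -ᵛ z))) + k * k * ∣ x -ᵛ z ∣²
  dilation-norm z x k = solve 7 (λ z₀ z₁ z₂ x₀ x₁ x₂ k →
    let Z = z₀ ∷ z₁ ∷ z₂ ∷ []
        X = x₀ ∷ x₁ ∷ x₂ ∷ []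
        D = λ i → X i :- Z i
        W = λ i → Z i :+ k :* D i
    in W :· W := Z :· Z :+ k :* (:2 :* (Z :· D)) :+ k :* k :* (D :· D))
    (z 0F) (z 1F) (z 2F) (x 0F) (x 1F) (x 2F) k

  norm-about : ∀ (z x : ℝ³) → ∣ x ∣² ≈ ∣ z ∣² + 2# * (z · (x -ᵛ z)) + ∣ x -ᵛ z ∣²
  norm-about z x = solve 6 (λ z₀ z₁ z₂ x₀ x₁ x₂ →
    let Z = z₀ ∷ z₁ ∷ z₂ ∷ []
        X = x₀ ∷ x₁ ∷ x₂ ∷ []
        D = λ i → X i :- Z i
    in X :· X := Z :· Z :+ :2 :* (Z :· D) :+ D :· D)
    (z 0F) (z 1F) (z 2F) (x 0F) (x 1F) (x 2F)

  mirror-sphere : ∀ z r r≉0 x i → let S = sphere z r r≉0 in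
    mirror (inversiveCoordinates S) (lift (just x)) i
      ≈ lift (just x) i + (r ⁻¹[ r≉0 ] * ∣ x -ᵛ z ∣² - r) * inversiveCoordinates S i
  mirror-sphere z r r≉0 x i = +-congˡ (*-congʳ
    (trans (⟪⟫-comm (lift (just x)) (inversiveCoordinates (sphere z r r≉0)))
           (sphere-lift z r r≉0 x)))

  -- The reflected light-cone vector represents the reflected point up to scale. The factor is
  -- `∣ x - z ∣² / r²` for an inversion, `1 / r²` when ∞ goes to the centre, `r²` when the centre
  -- goes to ∞, and 1 for a plane. Its positivity preserves the sides of spheres.
  lift-reflect : ∀ S p → ∃ λ k → 0# < k ×
    (λ i → k * lift (reflect S p) i) ≋ mirror (inversiveCoordinates S) (lift p)
  lift-reflect S@(sphere z r r≉0) nothing = b * b , x≉0⇒0<x*x (⁻¹-nonzero r≉0) , agrees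
    where
    b = r ⁻¹[ r≉0 ]
    v = inversiveCoordinates S

    mirror≈ : ∀ i → mirror v (lift nothing) i ≈ lift nothing i + b * v i
    mirror≈ i = +-congˡ (*-congʳ (trans (⟪⟫-comm (lift nothing) v) (∞-lift v)))

    agrees : (λ i → b * b * lift (just z) i) ≋ mirror v (lift nothing)
    agrees 0F = trans (modulo 1# (⁻¹-inverseˡ r r≉0)
      (solve 3 (λ b r N → b :* b :* N := :1 :+ b :* (b :* N :- r) :+ :1 :* (b :* r :- :1))
        b r ∣ z ∣²)) (sym (mirror≈ 0F))
    agrees 1F = trans (solve 1 (λ b → b :* b :* :1 := con (+ 0) :+ b :* b) b)
      (sym (mirror≈ 1F))
    agrees (suc (suc i)) =
      trans (solve 2 (λ b zᵢ → b :* b :* zᵢ := con (+ 0) :+ b :* (b :* zᵢ)) b (z i))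
        (sym (mirror≈ (suc (suc i))))
  lift-reflect S@(sphere z r r≉0) (just x) with ∣ x -ᵛ z ∣² ≟ 0#
  ... | yes d≈0 = r * r , x≉0⇒0<x*x r≉0 , agrees
    where
    b = r ⁻¹[ r≉0 ]
    d = ∣ x -ᵛ z ∣²
    v = inversiveCoordinates S

    x≋z : ∀ i → x i ≈ z i
    x≋z i = x-y≈0⇒x≈y (u·u≈0⇒u≈0 (x -ᵛ z) d≈0 i)

    agrees : (λ i → r * r * lift nothing i) ≋ mirror v (lift (just x))
    agrees 0F = sym (begin
      mirror v (lift (just x)) 0F                          ≈⟨ mirror-sphere z r r≉0 x 0F ⟩
      ∣ x ∣² + (b * d - r) * (b * ∣ z ∣² - r)
        ≈⟨ +-cong (sum-cong-≋ (λ i → *-cong (x≋z i) (x≋z i))) (*-congʳ (+-congʳ (*-congˡ d≈0))) ⟩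
      ∣ z ∣² + (b * 0# - r) * (b * ∣ z ∣² - r)             ≈⟨ modulo (- ∣ z ∣²) (⁻¹-inverseˡ r r≉0)
        (solve 3 (λ b r N → N :+ (b :* con (+ 0) :- r) :* (b :* N :- r)
                         := r :* r :* :1 :+ :- N :* (b :* r :- :1)) b r ∣ z ∣²) ⟩
      r * r * 1#                                           ∎)
    agrees 1F = sym (begin
      mirror v (lift (just x)) 1F    ≈⟨ mirror-sphere z r r≉0 x 1F ⟩
      1# + (b * d - r) * b           ≈⟨ +-congˡ (*-congʳ (+-congʳ (*-congˡ d≈0))) ⟩
      1# + (b * 0# - r) * b          ≈⟨ modulo (- 1#) (⁻¹-inverseˡ r r≉0)
        (solve 2 (λ b r → :1 :+ (b :* con (+ 0) :- r) :* b
                       := r :* r :* con (+ 0) :+ :- :1 :* (b :* r :- :1)) b r) ⟩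
      r * r * 0#                     ∎)
    agrees (suc (suc i)) = sym (begin
      mirror v (lift (just x)) (suc (suc i))   ≈⟨ mirror-sphere z r r≉0 x (suc (suc i)) ⟩
      x i + (b * d - r) * (b * z i)            ≈⟨ +-cong (x≋z i) (*-congʳ (+-congʳ (*-congˡ d≈0))) ⟩
      z i + (b * 0# - r) * (b * z i)           ≈⟨ modulo (- z i) (⁻¹-inverseˡ r r≉0)
        (solve 3 (λ b r zᵢ → zᵢ :+ (b :* con (+ 0) :- r) :* (b :* zᵢ)
                          := r :* r :* con (+ 0) :+ :- zᵢ :* (b :* r :- :1)) b r (z i)) ⟩
      r * r * 0#                               ∎)
  ... | no d≉0 = b * b * d , *-pos (x≉0⇒0<x*x (⁻¹-nonzero r≉0)) 0<d , agrees
    where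
    b = r ⁻¹[ r≉0 ]
    d = ∣ x -ᵛ z ∣²
    e = d ⁻¹[ d≉0 ]
    v = inversiveCoordinates S
    g = z · (x -ᵛ z)

    0<d : 0# < d
    0<d with 0≤u·u (x -ᵛ z)
    ... | inj₁ 0<d = 0<d
    ... | inj₂ 0≈d = contradiction (sym 0≈d) d≉0

    x′ : ℝ³
    x′ i = z i + r * r * e * (x i - z i)

    agrees : (λ i → b * b * d * lift (just x′) i) ≋ mirror v (lift (just x))
    agrees 0F = begin
      b * b * d * ∣ x′ ∣²
        ≈⟨ *-congˡ (dilation-norm z x (r * r * e)) ⟩
      b * b * d * (∣ z ∣² + r * r * e * (2# * g) + r * r * e * (r * r * e) * d)
        -- In terms of `X = b r` and `Y = d e`, both equal to 1, the two sides differ by `2 g (X² Y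
        -- - 1) + r² (X² Y² - 1) + (d + N) (X - 1)`. The cofactors come from splitting `X Y -
        -- 1` as `(X - 1) + X (Y - 1)`.
        ≈⟨ modulo _ (⁻¹-inverseˡ r r≉0) (modulo _ (⁻¹-inverseʳ d d≉0) (solve 6 (λ b r d e N g →
             let X = b :* r
                 Y = d :* e
             in  b :* b :* d :* (N :+ r :* r :* e :* (:2 :* g) :+ r :* r :* e :* (r :* r :* e) :* d)
              := N :+ :2 :* g :+ d :+ (b :* d :- r) :* (b :* N :- r)
                 :+ (:2 :* g :* (X :+ :1) :+ r :* r :* (X :* Y :+ :1) :+ d :+ N) :* (X :- :1)
                 :+ (:2 :* g :* X :* X :+ r :* r :* (X :* Y :+ :1) :* X) :* (Y :- :1))
             b r d e ∣ z ∣² g)) ⟩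
      ∣ z ∣² + 2# * g + d + (b * d - r) * (b * ∣ z ∣² - r)
        ≈⟨ +-congʳ (norm-about z x) ⟨
      ∣ x ∣² + (b * d - r) * (b * ∣ z ∣² - r)
        ≈⟨ mirror-sphere z r r≉0 x 0F ⟨
      mirror v (lift (just x)) 0F ∎
    agrees 1F = begin
      b * b * d * 1#                 ≈⟨ modulo 1# (⁻¹-inverseˡ r r≉0)
        (solve 3 (λ b r d → b :* b :* d :* :1
                         := :1 :+ (b :* d :- r) :* b :+ :1 :* (b :* r :- :1)) b r d) ⟩
      1# + (b * d - r) * b           ≈⟨ mirror-sphere z r r≉0 x 1F ⟨
      mirror v (lift (just x)) 1F    ∎
    agrees (suc (suc i)) = begin
      b * b * d * x′ i
        ≈⟨ modulo _ (⁻¹-inverseˡ r r≉0) (modulo _ (⁻¹-inverseʳ d d≉0) (solve 6 (λ b r d e zᵢ xᵢ →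
             let X = b :* r
                 Y = d :* e
             in  b :* b :* d :* (zᵢ :+ r :* r :* e :* (xᵢ :- zᵢ))
              := xᵢ :+ (b :* d :- r) :* (b :* zᵢ)
                 :+ ((xᵢ :- zᵢ) :* (X :+ :1) :+ zᵢ) :* (X :- :1)
                 :+ (xᵢ :- zᵢ) :* X :* X :* (Y :- :1))
             b r d e (z i) (x i))) ⟩
      x i + (b * d - r) * (b * z i)
        ≈⟨ mirror-sphere z r r≉0 x (suc (suc i)) ⟨
      mirror v (lift (just x)) (suc (suc i)) ∎
  lift-reflect S@(plane n h n·n≈1) nothing = 1# , 0<1 , λ i → begin
    1# * lift nothing i                       ≈⟨ solve 2 (λ l v → :1 :* l := l :+ con (+ 0) :* v) _ _ ⟩
    lift nothing i + 0# * v i                 ≈⟨ +-congˡ (*-congʳ (trans (⟪⟫-comm (lift nothing) v) (∞-lift v))) ⟨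
    mirror v (lift nothing) i                 ∎
    where v = inversiveCoordinates S
  lift-reflect S@(plane n h n·n≈1) (just x) = 1# , 0<1 , agrees
    where
    v = inversiveCoordinates S

    x′ : ℝ³
    x′ i = x i - 2# * (n · x - h) * n i

    mirror≈ : ∀ i → mirror v (lift (just x)) i ≈ lift (just x) i + 2# * (h - n · x) * v i
    mirror≈ i = +-congˡ (*-congʳ (trans (⟪⟫-comm (lift (just x)) v) (plane-lift n h n·n≈1 x)))

    agrees : (λ i → 1# * lift (just x′) i) ≋ mirror v (lift (just x))
    agrees 0F = begin
      1# * ∣ x′ ∣²
        -- The point is displaced by `- 2 E n`; the squared length `4 E² ∣ n ∣²` of this
        -- displacement is where `n` being a unit vector enters.
        ≈⟨ modulo (4# * ((n · x - h) * (n · x - h))) n·n≈1 (solve 7 (λ h n₀ n₁ n₂ x₀ x₁ x₂ →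
             let N  = n₀ ∷ n₁ ∷ n₂ ∷ []
                 X  = x₀ ∷ x₁ ∷ x₂ ∷ []
                 E  = N :· X :- h
                 X′ = λ i → X i :- :2 :* E :* N i
             in  :1 :* (X′ :· X′)
              := X :· X :+ :2 :* (h :- N :· X) :* (:2 :* h) :+ :4 :* (E :* E) :* (N :· N :- :1))
             h (n 0F) (n 1F) (n 2F) (x 0F) (x 1F) (x 2F)) ⟩
      ∣ x ∣² + 2# * (h - n · x) * (2# * h)
        ≈⟨ mirror≈ 0F ⟨
      mirror v (lift (just x)) 0F ∎
    agrees 1F = trans
      (solve 1 (λ k → :1 :* :1 := :1 :+ k :* con (+ 0)) (2# * (h - n · x)))
      (sym (mirror≈ 1F))
    agrees (suc (suc i)) = trans
      (solve 4 (λ xᵢ nᵢ h nx → :1 :* (xᵢ :- :2 :* (nx :- h) :* nᵢ)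
                            := xᵢ :+ :2 :* (h :- nx) :* nᵢ) (x i) (n i) h (n · x))
      (sym (mirror≈ (suc (suc i))))

  -- Pulling spheres back along a Möbius transformation.

  -- The adjoint of the composite of reflections, hence its inverse. Adjoints reverse the order, so
  -- the head of the list, which acts last on points, acts first here.
  pullback : List OrientedSphere → Vector Carrier 5 → Vector Carrier 5
  pullback List.[]       v = v
  pullback (S List.∷ Ss) v = pullback Ss (mirror (inversiveCoordinates S) v)

  pullback-isometry : ∀ Ss v w → ⟪ pullback Ss v , pullback Ss w ⟫ ≈ ⟪ v , w ⟫
  pullback-isometry List.[]       v w = refl
  pullback-isometry (S List.∷ Ss) v w = trans
    (pullback-isometry Ss (mirror (inversiveCoordinates S) v) (mirror (inversiveCoordinates S) w))
    (mirror-isometry (inversiveCoordinates S) v w (coordinates-norm S))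

  -- Each reflection crosses the pairing by self-adjointness, and the positive factors of
  -- `lift-reflect` multiply.
  pullback-lift : ∀ Ss v p → ∃ λ k → 0# < k ×
    k * ⟪ v , lift (foldr reflect p Ss) ⟫ ≈ ⟪ pullback Ss v , lift p ⟫
  pullback-lift List.[]       v p = 1# , 0<1 , *-identityˡ _
  pullback-lift (S List.∷ Ss) v p
    with k , 0<k , k≈ ← lift-reflect S (foldr reflect p Ss)
       | l , 0<l , l≈ ← pullback-lift Ss (mirror (inversiveCoordinates S) v) p
    = l * k , *-pos 0<l 0<k , (begin
    l * k * ⟪ v , lift (reflect S q) ⟫              ≈⟨ *-assoc l k _ ⟩
    l * (k * ⟪ v , lift (reflect S q) ⟫)            ≈⟨ *-congˡ (⟪⟫-homoʳ v k (lift (reflect S q))) ⟨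
    l * ⟪ v , (λ i → k * lift (reflect S q) i) ⟫    ≈⟨ *-congˡ (⟪⟫-cong {v} (λ _ → refl) k≈) ⟩
    l * ⟪ v , mirror s (lift q) ⟫                   ≈⟨ *-congˡ (mirror-selfAdjoint s v (lift q)) ⟨
    l * ⟪ mirror s v , lift q ⟫                     ≈⟨ l≈ ⟩
    ⟪ pullback Ss (mirror s v) , lift p ⟫           ∎)
    where
    q = foldr reflect p Ss
    s = inversiveCoordinates S

  -- One inside point fixes the sign of the scalar in `coordinates-unique`: the centre of a ball, ∞
  -- for an exterior, and a point at height `h + 1` for a half-space.
  region-inhabited : ∀ S → ∃ (region S)
  region-inhabited (sphere z r r≉0) with compare 0# r
  ... | tri< 0<r _ _ = just z , inj₁ (0<r , <-respˡ-≈ (sym z-z≈0) (x≉0⇒0<x*x r≉0))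
    where
    z-z≈0 : ∣ z -ᵛ z ∣² ≈ 0#
    z-z≈0 = solve 3 (λ z₀ z₁ z₂ →
      let Z = z₀ ∷ z₁ ∷ z₂ ∷ []
          D = λ i → Z i :- Z i
      in D :· D := con (+ 0)) (z 0F) (z 1F) (z 2F)
  ... | tri≈ _ 0≈r _ = contradiction (sym 0≈r) r≉0
  ... | tri> _ _ r<0 = nothing , r<0
  region-inhabited (plane n h n·n≈1) =
    just (λ i → (h + 1#) * n i) , <-respʳ-≈ (sym n·x≈) h<1+h
    where
    h<1+h : h < 1# + h
    h<1+h = <-respˡ-≈ (+-identityˡ h) (+-monoˡ-< h 0<1)

    n·x≈ : n · (λ i → (h + 1#) * n i) ≈ 1# + h
    n·x≈ = modulo (h + 1#) n·n≈1 (solve 4 (λ h n₀ n₁ n₂ →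
      let N = n₀ ∷ n₁ ∷ n₂ ∷ []
      in N :· (λ i → (h :+ :1) :* N i) := :1 :+ h :+ (h :+ :1) :* (N :· N :- :1))
      h (n 0F) (n 1F) (n 2F))

  -- Recovering a sphere from its zeros and signs on the light cone.

  Vanishes : Vector Carrier 5 → OrientedSphere → Set _
  Vanishes v S = ∀ p → surface S p → ⟪ v , lift p ⟫ ≈ 0#

  module VanishesOnSphere z r r≉0 v (vanishes : Vanishes v (sphere z r r≉0)) where

    private
      b = r ⁻¹[ r≉0 ]
      c⃗ = inversiveCoordinates (sphere z r r≉0)

    -- z + r u and z - r u are both on the sphere when u is a unit vector.
    opposite-points : ∀ u → ∣ u ∣² ≈ 1# → space v · u ≈ bend v * (z · u)
    opposite-points u u·u≈1 = sym (x-y≈0⇒x≈y (*-cancelˡ-0 r≉0 (*-cancelˡ-0 2≉0 (*-cancelˡ-0 2≉0 (begin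
      2# * (2# * (r * (bend v * (z · u) - space v · u)))
        ≈⟨ solve 12 (λ v₀ v₁ v₂ v₃ v₄ r z₀ z₁ z₂ u₀ u₁ u₂ →
             let V = v₀ ∷ v₁ ∷ v₂ ∷ v₃ ∷ v₄ ∷ []
                 Z = z₀ ∷ z₁ ∷ z₂ ∷ []
                 U = u₀ ∷ u₁ ∷ u₂ ∷ []
                 P = λ i → Z i :+ r :* U i
                 M = λ i → Z i :+ :- r :* U i
             in :2 :* (:2 :* (r :* (v₁ :* (Z :· U) :- space V :· U)))
                  := :⟪ V , P :· P ∷ :1 ∷ P ⟫ :- :⟪ V , M :· M ∷ :1 ∷ M ⟫)
             (v 0F) (v 1F) (v 2F) (v 3F) (v 4F) r (z 0F) (z 1F) (z 2F) (u 0F) (u 1F) (u 2F) ⟩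
      ⟪ v , lift (point r) ⟫ - ⟪ v , lift (point (- r)) ⟫
        ≈⟨ x≈y⇒x-y≈0 (trans (vanishes (point r) (on r refl))
             (sym (vanishes (point (- r)) (on (- r) (solve 1 (λ r → :- r :* :- r := r :* r) r))))) ⟩
      0# ∎)))))
      where
      point : Carrier → ℝ̂³
      point s = just (λ i → z i + s * u i)

      on : ∀ s → s * s ≈ r * r → surface (sphere z r r≉0) (point s)
      on s ss≈rr = trans (modulo (s * s) u·u≈1 (solve 7 (λ s z₀ z₁ z₂ u₀ u₁ u₂ →
        let Z = z₀ ∷ z₁ ∷ z₂ ∷ []
            U = u₀ ∷ u₁ ∷ u₂ ∷ []
            D = λ i → Z i :+ s :* U i :- Z i
        in D :· D := s :* s :+ s :* s :* (U :· U :- :1))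
        s (z 0F) (z 1F) (z 2F) (u 0F) (u 1F) (u 2F))) ss≈rr

    bend≈ : bend v ≈ bend v * r * b
    bend≈ = modulo (- bend v) (⁻¹-inverseʳ r r≉0)
      (solve 3 (λ w b r → w := w :* r :* b :+ :- w :* (r :* b :- :1)) (bend v) b r)

    space≈ : ∀ i → space v i ≈ bend v * z i
    space≈ i = begin
      space v i                   ≈⟨ ·-axis (space v) i ⟨
      space v · axis i            ≈⟨ opposite-points (axis i) (axis-unit i) ⟩
      bend v * (z · axis i)       ≈⟨ *-congˡ (·-axis z i) ⟩
      bend v * z i                ∎

    -- The scalar is forced by the bends, since `c⃗` has bend `1 / r`. The spatial entries follow
    -- from opposite points along the axes.
    proportional : v ≋ (λ i → bend v * r * c⃗ i)
    proportional 0F = begin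
      v 0F
        -- Incidence with the single point `z + r e₁`, solved for `v 0F`; the other cofactors
        -- eliminate the spatial entries through `space≈`.
        ≈⟨ modulo 1# (vanishes (just (λ i → z i + r * axis 0F i)) on) (modulo (2# * r) (space≈ 0F)
           (modulo (2# * z 2F) (space≈ 2F) (modulo (2# * z 1F) (space≈ 1F) (modulo (2# * z 0F) (space≈ 0F)
             (solve 9 (λ v₀ v₁ v₂ v₃ v₄ r z₀ z₁ z₂ →
               let V = v₀ ∷ v₁ ∷ v₂ ∷ v₃ ∷ v₄ ∷ []
                   Z = z₀ ∷ z₁ ∷ z₂ ∷ []
                   X = z₀ :+ r :* :1 ∷ z₁ :+ r :* con (+ 0) ∷ z₂ :+ r :* con (+ 0) ∷ []
               in v₀ := v₁ :* (Z :· Z :- r :* r)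
                        :+ :1 :* (:⟪ V , X :· X ∷ :1 ∷ X ⟫ :- con (+ 0))
                        :+ :2 :* r :* (v₂ :- v₁ :* z₀)
                        :+ :2 :* z₂ :* (v₄ :- v₁ :* z₂)
                        :+ :2 :* z₁ :* (v₃ :- v₁ :* z₁)
                        :+ :2 :* z₀ :* (v₂ :- v₁ :* z₀))
               (v 0F) (v 1F) (v 2F) (v 3F) (v 4F) r (z 0F) (z 1F) (z 2F)))))) ⟩
      bend v * (∣ z ∣² - r * r)
        ≈⟨ modulo (- (bend v * ∣ z ∣²)) (⁻¹-inverseʳ r r≉0)
             (solve 4 (λ w b r N → w :* (N :- r :* r)
                := w :* r :* (b :* N :- r) :+ :- (w :* N) :* (r :* b :- :1)) (bend v) b r ∣ z ∣²) ⟩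
      bend v * r * c⃗ 0F ∎
      where
      on : surface (sphere z r r≉0) (just (λ i → z i + r * axis 0F i))
      on = solve 4 (λ r z₀ z₁ z₂ →
        let Z = z₀ ∷ z₁ ∷ z₂ ∷ []
            U = :1 ∷ con (+ 0) ∷ con (+ 0) ∷ []
            D = λ i → Z i :+ r :* U i :- Z i
        in D :· D := r :* r) r (z 0F) (z 1F) (z 2F)
    proportional 1F = bend≈
    proportional (suc (suc i)) = begin
      space v i               ≈⟨ space≈ i ⟩
      bend v * z i            ≈⟨ *-congʳ bend≈ ⟩
      bend v * r * b * z i    ≈⟨ *-assoc _ b (z i) ⟩
      bend v * r * (b * z i)  ∎

  module VanishesOnPlane n h n·n≈1 v (vanishes : Vanishes v (plane n h n·n≈1)) where

    private
      t = space v · n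

    bend≈0 : bend v ≈ 0#
    bend≈0 = trans (sym (∞-lift v)) (vanishes nothing tt)

    -- h n plus the component of u orthogonal to n lies on the plane.
    projected-point : ∀ u → v 0F ≈ t * (2# * h) + 2# * (space v · u - t * (n · u))
    projected-point u =
      modulo 1# (vanishes (just x) on) (modulo (- ∣ x ∣²) bend≈0
        (solve 12 (λ v₀ v₁ v₂ v₃ v₄ h n₀ n₁ n₂ u₀ u₁ u₂ →
           let V = v₀ ∷ v₁ ∷ v₂ ∷ v₃ ∷ v₄ ∷ []
               N = n₀ ∷ n₁ ∷ n₂ ∷ []
               U = u₀ ∷ u₁ ∷ u₂ ∷ []
               X = λ i → h :* N i :+ (U i :- (N :· U) :* N i)
               T = space V :· N
           in v₀ := T :* (:2 :* h) :+ :2 :* (space V :· U :- T :* (N :· U))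
                    :+ :1 :* (:⟪ V , X :· X ∷ :1 ∷ X ⟫ :- con (+ 0))
                    :+ :- (X :· X) :* (v₁ :- con (+ 0)))
           (v 0F) (v 1F) (v 2F) (v 3F) (v 4F) h (n 0F) (n 1F) (n 2F) (u 0F) (u 1F) (u 2F)))
      where
      x : ℝ³
      x i = h * n i + (u i - n · u * n i)

      on : n · x ≈ h
      on = modulo (h - n · u) n·n≈1 (solve 7 (λ h n₀ n₁ n₂ u₀ u₁ u₂ →
        let N = n₀ ∷ n₁ ∷ n₂ ∷ []
            U = u₀ ∷ u₁ ∷ u₂ ∷ []
        in N :· (λ i → h :* N i :+ (U i :- N :· U :* N i))
             := h :+ (h :- N :· U) :* (N :· N :- :1))
        h (n 0F) (n 1F) (n 2F) (u 0F) (u 1F) (u 2F))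

    first≈ : v 0F ≈ t * (2# * h)
    first≈ = trans (projected-point (λ _ → 0#)) (solve 7 (λ h n₀ n₁ n₂ v₂ v₃ v₄ →
      let N = n₀ ∷ n₁ ∷ n₂ ∷ []
          X = v₂ ∷ v₃ ∷ v₄ ∷ []
          O = λ _ → con (+ 0)
          T = X :· N
      in T :* (:2 :* h) :+ :2 :* (X :· O :- T :* (N :· O)) := T :* (:2 :* h))
      h (n 0F) (n 1F) (n 2F) (v 2F) (v 3F) (v 4F))

    -- The left-hand side of `projected-point` does not depend on `u`. Comparing `u = 0` with `u` an
    -- axis shows that `space v` has no component orthogonal to `n`.
    space≈ : ∀ i → space v i ≈ t * n i
    space≈ i = begin
      space v i             ≈⟨ ·-axis (space v) i ⟨
      space v · axis i      ≈⟨ x-y≈0⇒x≈y (*-cancelˡ-0 2≉0 (begin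
        2# * (space v · axis i - t * (n · axis i))
          ≈⟨ solve 2 (λ x y → y := x :+ y :- x) (t * (2# * h)) _ ⟩
        t * (2# * h) + 2# * (space v · axis i - t * (n · axis i)) - t * (2# * h)
          ≈⟨ x≈y⇒x-y≈0 (trans (sym (projected-point (axis i))) first≈) ⟩
        0# ∎)) ⟩
      t * (n · axis i)      ≈⟨ *-congˡ (·-axis n i) ⟩
      t * n i               ∎

    proportional : v ≋ (λ i → t * inversiveCoordinates (plane n h n·n≈1) i)
    proportional 0F            = first≈
    proportional 1F            = trans bend≈0 (sym (zeroʳ t))
    proportional (suc (suc i)) = space≈ i

  vanishes⇒proportional : ∀ S v → Vanishes v S → ∃ λ t → v ≋ (λ i → t * inversiveCoordinates S i)
  vanishes⇒proportional (sphere z r r≉0) v vanishes =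
    bend v * r , VanishesOnSphere.proportional z r r≉0 v vanishes
  vanishes⇒proportional (plane n h n·n≈1) v vanishes =
    space v · n , VanishesOnPlane.proportional n h n·n≈1 v vanishes

  -- The zeros give `v = t s`, the sign at one inside point gives `t > 0`, and the equal nonzero
  -- norms give `t² = 1`.
  coordinates-unique : ∀ S v → ⟪ v , v ⟫ ≈ - 2# → Vanishes v S →
                       (∀ p → region S p → ⟪ v , lift p ⟫ < 0#) →
                       v ≋ inversiveCoordinates S
  coordinates-unique S v vv≈-2 vanishes negative
    with t , v≋ts ← vanishes⇒proportional S v vanishes
       | p , inside ← region-inhabited S
    = λ i → trans (v≋ts i) (trans (*-congʳ t≈1) (*-identityˡ (s i)))
    where
    s = inversiveCoordinates S

    v-pairing : ∀ w → ⟪ v , w ⟫ ≈ t * ⟪ s , w ⟫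
    v-pairing w = begin
      ⟪ v , w ⟫                    ≈⟨ ⟪⟫-cong {v} {λ i → t * s i} {w} v≋ts (λ _ → refl) ⟩
      ⟪ (λ i → t * s i) , w ⟫      ≈⟨ ⟪⟫-comm (λ i → t * s i) w ⟩
      ⟪ w , (λ i → t * s i) ⟫      ≈⟨ ⟪⟫-homoʳ w t s ⟩
      t * ⟪ w , s ⟫                ≈⟨ *-congˡ (⟪⟫-comm w s) ⟩
      t * ⟪ s , w ⟫                ∎

    0<t : 0# < t
    0<t with compare 0# t
    ... | tri< 0<t _ _ = 0<t
    ... | tri≈ _ 0≈t _ = contradiction (negative p inside)
      (irrefl (trans (v-pairing (lift p)) (trans (*-congʳ (sym 0≈t)) (zeroˡ _))))
    ... | tri> _ _ t<0 = <-asym (negative p inside)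
      (<-respʳ-≈ (sym (v-pairing (lift p))) (neg*neg t<0 (region⇒<0 S p inside)))

    tt≈1 : t * t ≈ 1#
    tt≈1 = sym (*-cancelˡ (λ ss≈0 → 2≉0 (-x≈0⇒x≈0 (trans (sym (coordinates-norm S)) ss≈0))) (begin
      ⟪ s , s ⟫ * 1#             ≈⟨ *-identityʳ _ ⟩
      ⟪ s , s ⟫                  ≈⟨ trans (coordinates-norm S) (sym vv≈-2) ⟩
      ⟪ v , v ⟫                  ≈⟨ v-pairing v ⟩
      t * ⟪ s , v ⟫              ≈⟨ *-congˡ (trans (⟪⟫-comm s v) (v-pairing s)) ⟩
      t * (t * ⟪ s , s ⟫)        ≈⟨ solve 2 (λ t q → t :* (t :* q) := q :* (t :* t)) t ⟪ s , s ⟫ ⟩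
      ⟪ s , s ⟫ * (t * t)        ∎))

    t≈1 : t ≈ 1#
    t≈1 = x-y≈0⇒x≈y (*-cancelˡ-0 {t + 1#}
      (λ t+1≈0 → irrefl (sym t+1≈0) (+-pos-nonneg 0<t (inj₁ 0<1)))
      (begin
        (t + 1#) * (t - 1#)    ≈⟨ solve 1 (λ t → (t :+ :1) :* (t :- :1) := t :* t :- :1) t ⟩
        t * t - 1#             ≈⟨ x≈y⇒x-y≈0 tt≈1 ⟩
        0#                     ∎))

  -- Pulling back keeps the norm and, up to a positive factor, every pairing with a point. The
  -- result therefore has the zeros and signs that single out the coordinates of `S`. In this way
  -- `f` acts on coordinates as one linear isometry.
  maps⇒pullback : ∀ Ss f S T → (∀ p → f p ≈̂ foldr reflect p Ss) → f maps S to T →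
                  pullback Ss (inversiveCoordinates T) ≋ inversiveCoordinates S
  maps⇒pullback Ss f S T f≈ f-maps =
    coordinates-unique S v
      (trans (pullback-isometry Ss t t) (coordinates-norm T)) vanishes negative
    where
    t = inversiveCoordinates T
    v = pullback Ss t

    t-lift : ∀ p → ⟪ t , lift (f p) ⟫ ≈ ⟪ t , lift (foldr reflect p Ss) ⟫
    t-lift p = ⟪⟫-cong {t} (λ _ → refl) (lift-cong (f≈ p))

    vanishes : Vanishes v S
    vanishes p on with k , _ , k≈ ← pullback-lift Ss t p = begin
      ⟪ v , lift p ⟫                              ≈⟨ k≈ ⟨
      k * ⟪ t , lift (foldr reflect p Ss) ⟫       ≈⟨ *-congˡ (t-lift p) ⟨
      k * ⟪ t , lift (f p) ⟫                      ≈⟨ *-congˡ (surface⇒≈0 T (f p) (Equivalence.to (proj₁ (f-maps p)) on)) ⟩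
      k * 0#                                      ≈⟨ zeroʳ k ⟩
      0#                                          ∎

    negative : ∀ p → region S p → ⟪ v , lift p ⟫ < 0#
    negative p inside with k , 0<k , k≈ ← pullback-lift Ss t p =
      <-respˡ-≈ (trans (*-congˡ (t-lift p)) k≈)
        (pos*neg 0<k (region⇒<0 T (f p) (Equivalence.to (proj₂ (f-maps p)) inside)))

  -- Common points of tangent spheres.

  -- The point is the spatial part divided by the bend; nullity says `w 0F * bend w = ∣ space w ∣²`,
  -- which makes the first entry agree.
  null⇒lift : ∀ w → ⟪ w , w ⟫ ≈ 0# → bend w ≉ 0# →
              ∃ λ x → (λ i → bend w * lift (just x) i) ≋ w
  null⇒lift w ww≈0 b≉0 = (λ i → k * space w i) , agrees
    where
    b = bend w
    k = b ⁻¹[ b≉0 ]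

    norm : w 0F * b ≈ space w · space w
    norm = x-y≈0⇒x≈y (*-cancelˡ-0 2≉0 (trans (solve 5 (λ w₀ w₁ w₂ w₃ w₄ →
      let W = w₀ ∷ w₁ ∷ w₂ ∷ w₃ ∷ w₄ ∷ []
      in :2 :* (w₀ :* w₁ :- space W :· space W) := :⟪ W , W ⟫)
      (w 0F) (w 1F) (w 2F) (w 3F) (w 4F)) ww≈0))

    agrees : (λ i → b * lift (just (λ i → k * space w i)) i) ≋ w
    agrees 0F = modulo (w 0F * (b * k + 1#)) (⁻¹-inverseʳ b b≉0) (modulo (- (b * k * k)) norm
      (solve 6 (λ k w₀ w₁ w₂ w₃ w₄ →
        let X = w₂ ∷ w₃ ∷ w₄ ∷ []
            Y = λ i → k :* X i
        in w₁ :* (Y :· Y) := w₀ :+ w₀ :* (w₁ :* k :+ :1) :* (w₁ :* k :- :1)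
                             :+ :- (w₁ :* k :* k) :* (w₀ :* w₁ :- X :· X))
        k (w 0F) (w 1F) (w 2F) (w 3F) (w 4F)))
    agrees 1F            = *-identityʳ b
    agrees (suc (suc i)) = modulo (space w i) (⁻¹-inverseʳ b b≉0)
      (solve 3 (λ b k x → b :* (k :* x) := x :+ x :* (b :* k :- :1)) b k (space w i))

  -- The sum of the coordinates of two externally tangent spheres is null, and
  -- represents the point of tangency.
  tangent⇒meet : ∀ S T → let s = inversiveCoordinates S ; t = inversiveCoordinates T in
                 0# ≤ bend s → 0# ≤ bend t → ⟪ s , t ⟫ ≈ 2# → ∃ λ p → surface S p × surface T p
  tangent⇒meet S T 0≤bs 0≤bt st≈2 = meet
    where
    s = inversiveCoordinates S
    t = inversiveCoordinates T

    s+t : Vector Carrier 5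
    s+t i = s i + 1# * t i

    pairing-sum : ∀ u → ⟪ u , s+t ⟫ ≈ ⟪ u , s ⟫ + ⟪ u , t ⟫
    pairing-sum u = trans (⟪⟫-linearʳ u s 1# t) (+-congˡ (*-identityˡ _))

    s⊥s+t : ⟪ s , s+t ⟫ ≈ 0#
    s⊥s+t = trans (pairing-sum s) (trans (+-cong (coordinates-norm S) st≈2) (-‿inverseˡ 2#))

    t⊥s+t : ⟪ t , s+t ⟫ ≈ 0#
    t⊥s+t = trans (pairing-sum t)
      (trans (+-cong (trans (⟪⟫-comm t s) st≈2) (coordinates-norm T)) (-‿inverseʳ 2#))

    null : ⟪ s+t , s+t ⟫ ≈ 0#
    null = trans (pairing-sum s+t) (trans
      (+-cong (trans (⟪⟫-comm s+t s) s⊥s+t) (trans (⟪⟫-comm s+t t) t⊥s+t)) (+-identityʳ 0#))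

    meet-at-∞ : bend s ≈ 0# × bend t ≈ 0# → ∃ λ p → surface S p × surface T p
    meet-at-∞ (bs≈0 , bt≈0) = nothing
      , ≈0⇒surface S nothing (trans (∞-lift s) bs≈0)
      , ≈0⇒surface T nothing (trans (∞-lift t) bt≈0)

    meet-at : bend s+t ≉ 0# → (∃ λ x → (λ i → bend s+t * lift (just x) i) ≋ s+t) →
              ∃ λ p → surface S p × surface T p
    meet-at b≉0 (x , x≋) = just x
      , ≈0⇒surface S (just x) (⊥x s s⊥s+t)
      , ≈0⇒surface T (just x) (⊥x t t⊥s+t)
      where
      ⊥x : ∀ u → ⟪ u , s+t ⟫ ≈ 0# → ⟪ u , lift (just x) ⟫ ≈ 0#
      ⊥x u u⊥ = *-cancelˡ-0 b≉0 (begin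
        bend s+t * ⟪ u , lift (just x) ⟫                 ≈⟨ ⟪⟫-homoʳ u (bend s+t) (lift (just x)) ⟨
        ⟪ u , (λ i → bend s+t * lift (just x) i) ⟫       ≈⟨ ⟪⟫-cong {u} (λ _ → refl) x≋ ⟩
        ⟪ u , s+t ⟫                                      ≈⟨ u⊥ ⟩
        0#                                               ∎)

    meet : ∃ λ p → surface S p × surface T p
    meet with bend s+t ≟ 0#
    -- Nonnegative bends that add up to 0 both vanish, so both surfaces are planes and share ∞.
    ... | yes b≈0 = meet-at-∞
      (nonneg-sum≈0 0≤bs 0≤bt (trans (+-congˡ (sym (*-identityˡ (bend t)))) b≈0))
    ... | no b≉0 = meet-at b≉0 (null⇒lift s+t null b≉0)

-- The dual basis and the standard configuration.

module OrthoplicialConfiguration {c ℓ₁ ℓ₂} (ℝ : Reals c ℓ₁ ℓ₂) where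

  open Reals ℝ
  open Orthoplicial ℝ
  open InversiveGeometry ℝ
  open VecEquality setoid using (_≋_)
  open import Algebra.Properties.CommutativeMonoid.Sum +-commutativeMonoid using (sum-permute)
  open import Relation.Binary.Reasoning.Setoid setoid

  ½-inverse : 2# * ½ ≈ 1#
  ½-inverse = ⁻¹-inverseʳ 2# _

  -- The Gram matrix of `⟪_,_⟫` has inverse `- 1/4` times `Q-W`; its rows form the dual basis, which
  -- turns coordinates into pairings. This is how `Q-W` enters the result.
  dual : Fin 5 → Vector Carrier 5
  dual l i = - (½ * ½) * Q-W l i

  :0 : ∀ {n} → Polynomial n
  :0 = con (+ 0)

  :Q-F : ∀ {n} → Fin 5 → Vector (Polynomial n) 5
  :Q-F =
      (:1    ∷ :0    ∷ :0    ∷ :0    ∷ :- :1 ∷ [])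
    ∷ (:0    ∷ :1    ∷ :0    ∷ :0    ∷ :- :1 ∷ [])
    ∷ (:0    ∷ :0    ∷ :1    ∷ :0    ∷ :- :1 ∷ [])
    ∷ (:0    ∷ :0    ∷ :0    ∷ :1    ∷ :- :1 ∷ [])
    ∷ (:- :1 ∷ :- :1 ∷ :- :1 ∷ :- :1 ∷ :2    ∷ [])
    ∷ []

  :Q-W : ∀ {n} → Fin 5 → Vector (Polynomial n) 5
  :Q-W =
      (:0    ∷ :- :4 ∷ :0 ∷ :0 ∷ :0 ∷ [])
    ∷ (:- :4 ∷ :0    ∷ :0 ∷ :0 ∷ :0 ∷ [])
    ∷ (:0    ∷ :0    ∷ :2 ∷ :0 ∷ :0 ∷ [])
    ∷ (:0    ∷ :0    ∷ :0 ∷ :2 ∷ :0 ∷ [])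
    ∷ (:0    ∷ :0    ∷ :0 ∷ :0 ∷ :2 ∷ [])
    ∷ []

  dual-pairing : ∀ v l → ⟪ v , dual l ⟫ ≈ v l
  -- The pairing evaluates to `(2# * ½)²` times `v l`, and the cofactor comes from
  -- `x² - 1 = (x + 1) (x - 1)`.
  dual-pairing v l = modulo (v l * (2# * ½ + 1#)) ½-inverse (identity l)
    where
    ρ : Vec Carrier 6
    ρ = ½ Vec.∷ v 0F Vec.∷ v 1F Vec.∷ v 2F Vec.∷ v 3F Vec.∷ v 4F Vec.∷ Vec.[]

    sides : ∀ l → Polynomial 6 × Polynomial 6
    sides l =
      let h = var 0F
          V = λ i → var (suc i)
      in :⟪ V , (λ i → :- (h :* h) :* :Q-W l i) ⟫
       , V l :+ V l :* (:2 :* h :+ :1) :* (:2 :* h :- :1)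

    by : ∀ l {same : SameNormalForm (proj₁ (sides l)) (proj₂ (sides l))} →
         ⟦ proj₁ (sides l) ⟧ ρ ≈ ⟦ proj₂ (sides l) ⟧ ρ
    by l {same} = normalForm-sound ρ (proj₁ (sides l)) (proj₂ (sides l)) same

    identity : ∀ l → ⟪ v , dual l ⟫ ≈ v l + v l * (2# * ½ + 1#) * (2# * ½ - 1#)
    identity 0F = by 0F
    identity 1F = by 1F
    identity 2F = by 2F
    identity 3F = by 3F
    identity 4F = by 4F

  -- The sum of any two antipodal vectors of the standard configuration.
  σ : Vector Carrier 5
  σ = 2# ∷ 2# ∷ 0# ∷ 0# ∷ 0# ∷ []

  :σ : ∀ {n} → Vector (Polynomial n) 5
  :σ = :2 ∷ :2 ∷ :0 ∷ :0 ∷ :0 ∷ []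

  :standard : ∀ {n} → Polynomial n → Fin 8 → Vector (Polynomial n) 5
  :standard r =
      (:2 ∷ :0 ∷ :0   ∷ :0   ∷ :1    ∷ [])
    ∷ (:2 ∷ :0 ∷ :0   ∷ :0   ∷ :- :1 ∷ [])
    ∷ (:1 ∷ :1 ∷ r    ∷ :0   ∷ :0    ∷ [])
    ∷ (:1 ∷ :1 ∷ :0   ∷ r    ∷ :0    ∷ [])
    ∷ (:0 ∷ :2 ∷ :0   ∷ :0   ∷ :- :1 ∷ [])
    ∷ (:0 ∷ :2 ∷ :0   ∷ :0   ∷ :1    ∷ [])
    ∷ (:1 ∷ :1 ∷ :- r ∷ :0   ∷ :0    ∷ [])
    ∷ (:1 ∷ :1 ∷ :0   ∷ :- r ∷ :0    ∷ [])
    ∷ []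

  Opposite : Fin 8 → Fin 8 → Set
  Opposite i j = toℕ i % 4 ≡ toℕ j % 4

  -- Decided for all pairs by evaluation. The root can stay an indeterminate: distinct spheres
  -- having it in the same coordinate are opposite, so its square never occurs.
  standard-tangent-check : ∀ i j → ¬ Opposite i j →
    SameNormalForm {1} :⟪ :standard (var 0F) i , :standard (var 0F) j ⟫ :2
  standard-tangent-check = toWitness {a? = all? λ i → all? λ j →
    ¬? (toℕ i % 4 ℕ.≟ toℕ j % 4) →-dec T? _} _

  standard-antipodal-check : ∀ i j → i ≢ j → Opposite i j → ∀ l →
    SameNormalForm {1} (:standard (var 0F) i l :+ :1 :* :standard (var 0F) j l) (:σ l)
  standard-antipodal-check = toWitness {a? = all? λ i → all? λ j →
    ¬? (i Fin.≟ j) →-dec (toℕ i % 4 ℕ.≟ toℕ j % 4) →-dec all? λ l → T? _} _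

  module Standard (√2 : Carrier) (√2-square : √2 * √2 ≈ 2#) where

    private
      s : Fin 8 → Vector Carrier 5
      s = standardCoordinates √2

      ρ : Vec Carrier 1
      ρ = √2 Vec.∷ Vec.[]

    entries : ∀ {v w : Vector Carrier 5} → v 0F ≈ w 0F → v 1F ≈ w 1F → v 2F ≈ w 2F →
              v 3F ≈ w 3F → v 4F ≈ w 4F → v ≋ w
    entries e₀ e₁ e₂ e₃ e₄ 0F = e₀
    entries e₀ e₁ e₂ e₃ e₄ 1F = e₁
    entries e₀ e₁ e₂ e₃ e₄ 2F = e₂
    entries e₀ e₁ e₂ e₃ e₄ 3F = e₃
    entries e₀ e₁ e₂ e₃ e₄ 4F = e₄

    s≋ : ∀ k → s k ≋ (λ l → ⟦ :standard (var 0F) k l ⟧ ρ)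
    s≋ 0F = entries refl refl refl refl refl
    s≋ 1F = entries refl refl refl refl refl
    s≋ 2F = entries refl refl refl refl refl
    s≋ 3F = entries refl refl refl refl refl
    s≋ 4F = entries refl refl refl refl refl
    s≋ 5F = entries refl refl refl refl refl
    s≋ 6F = entries refl refl refl refl refl
    s≋ 7F = entries refl refl refl refl refl

    σ≋ : (λ l → ⟦ :σ l ⟧ ρ) ≋ σ
    σ≋ = entries refl refl refl refl refl

    standard-tangent : ∀ i j → ¬ Opposite i j → ⟪ s i , s j ⟫ ≈ 2#
    standard-tangent i j i≢j = trans (⟪⟫-cong (s≋ i) (s≋ j))
      (normalForm-sound ρ :⟪ :standard (var 0F) i , :standard (var 0F) j ⟫ :2
        (standard-tangent-check i j i≢j))

    standard-antipodal : ∀ i j → i ≢ j → Opposite i j → (λ l → s i l + 1# * s j l) ≋ σ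
    standard-antipodal i j i≢j i≡j l = trans (+-cong (s≋ i l) (*-congˡ (s≋ j l)))
      (trans (normalForm-sound ρ (:standard (var 0F) i l :+ :1 :* :standard (var 0F) j l) (:σ l)
               (standard-antipodal-check i j i≢j i≡j l))
             (σ≋ l))

    standard-bend-nonneg : ∀ k → 0# ≤ bend (s k)
    standard-bend-nonneg 0F = inj₂ refl
    standard-bend-nonneg 1F = inj₂ refl
    standard-bend-nonneg 2F = inj₁ 0<1
    standard-bend-nonneg 3F = inj₁ 0<1
    standard-bend-nonneg 4F = inj₁ 0<2
    standard-bend-nonneg 5F = inj₁ 0<2
    standard-bend-nonneg 6F = inj₁ 0<1
    standard-bend-nonneg 7F = inj₁ 0<1

    -- As matrices, the sum of `s k ⊗ s k` is `3 σ ⊗ σ + 2 Q-W`, and `2 Q-W` is `- 8` times the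
    -- inverse Gram matrix, whence the last term. Stating it through pairings lets isometries
    -- transport it. The square of the root appears only in the diagonal x and y entries.
    standard-frame : ∀ y z → sum (λ k → ⟪ s k , y ⟫ * ⟪ s k , z ⟫)
                   ≈ (1# + 2#) * (⟪ σ , y ⟫ * ⟪ σ , z ⟫) - 2# * 4# * ⟪ y , z ⟫
    standard-frame y z = modulo (2# * 4# * (y 2F * z 2F + y 3F * z 3F)) √2-square
      (solve 11 (λ r y₀ y₁ y₂ y₃ y₄ z₀ z₁ z₂ z₃ z₄ →
        let S = :standard r
            Y = y₀ ∷ y₁ ∷ y₂ ∷ y₃ ∷ y₄ ∷ []
            Z = z₀ ∷ z₁ ∷ z₂ ∷ z₃ ∷ z₄ ∷ []
        in (λ k → :⟪ S k , Y ⟫) :· (λ k → :⟪ S k , Z ⟫)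
             := (:1 :+ :2) :* (:⟪ :σ , Y ⟫ :* :⟪ :σ , Z ⟫) :- :2 :* :4 :* :⟪ Y , Z ⟫
                :+ :2 :* :4 :* (y₂ :* z₂ :+ y₃ :* z₃) :* (r :* r :- :2))
        √2 (y 0F) (y 1F) (y 2F) (y 3F) (y 4F) (z 0F) (z 1F) (z 2F) (z 3F) (z 4F))

  -- The Descartes form as a sum over eight vectors.

  descartesForm-entry : ∀ (A : Matrix 5 5) i → descartesForm (column A i) ≈ (A ᵀ ⊗ Q-F ⊗ A) i i
  descartesForm-entry A i = solve 5 (λ a b c d e →
    let X = a ∷ b ∷ c ∷ d ∷ e ∷ []
    in X :· (λ k → :Q-F k :· X) := (λ k → X :· (λ l → :Q-F l k)) :· X)
    (A 0F i) (A 1F i) (A 2F i) (A 3F i) (A 4F i)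

  -- In the sphere vectors vₖ and the antipodal vector μ, the Descartes form is
  -- Σ (vₖ - μ)² - 2 μ², which is unchanged when vₖ is replaced by 2 μ - vₖ.
  frame-entry : ∀ (A : Matrix 5 5) i j →
    let opposite = λ k l → 2# * A 4F l - A k l
        twice = λ l → 2# * A 4F l in
    2# * (A ᵀ ⊗ Q-F ⊗ A) i j ≈
      (A 0F i ∷ A 1F i ∷ A 2F i ∷ A 3F i ∷
       opposite 0F i ∷ opposite 1F i ∷ opposite 2F i ∷ opposite 3F i ∷ []) ·
      (A 0F j ∷ A 1F j ∷ A 2F j ∷ A 3F j ∷
       opposite 0F j ∷ opposite 1F j ∷ opposite 2F j ∷ opposite 3F j ∷ [])
      - (1# + 2#) * (twice i * twice j)
  frame-entry A i j = solve 10 (λ a b c d e a′ b′ c′ d′ e′ →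
    let X = a ∷ b ∷ c ∷ d ∷ e ∷ []
        Y = a′ ∷ b′ ∷ c′ ∷ d′ ∷ e′ ∷ []
    in :2 :* ((λ k → X :· (λ l → :Q-F l k)) :· Y) :=
       (a ∷ b ∷ c ∷ d ∷ :2 :* e :- a ∷ :2 :* e :- b ∷ :2 :* e :- c ∷ :2 :* e :- d ∷ []) :·
       (a′ ∷ b′ ∷ c′ ∷ d′ ∷ :2 :* e′ :- a′ ∷ :2 :* e′ :- b′ ∷ :2 :* e′ :- c′ ∷ :2 :* e′ :- d′ ∷ [])
       :- (:1 :+ :2) :* (:2 :* e :* (:2 :* e′)))
    (A 0F i) (A 1F i) (A 2F i) (A 3F i) (A 4F i) (A 0F j) (A 1F j) (A 2F j) (A 3F j) (A 4F j)

  -- Transport to an admissibly ordered configuration.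

  module Admissible
    (W : Vector OrientedSphere 8) (admissible : IsAdmissible W)
    (V : Vector OrientedSphere 8) (f : ℝ̂³ → ℝ̂³) (π : Permutation′ 8)
    (√2 : Carrier) (√2-square : √2 * √2 ≈ 2#)
    (V≋ : ∀ k → inversiveCoordinates (V k) ≋ standardCoordinates √2 k)
    (mirrors : List OrientedSphere) (f≈ : ∀ p → f p ≈̂ foldr reflect p mirrors)
    (f-maps : ∀ k → f maps V k to W (π ⟨$⟩ʳ k))
    where

    open Standard √2 √2-square

    private
      s : Fin 8 → Vector Carrier 5
      s = standardCoordinates √2

      w : Fin 8 → Vector Carrier 5
      w k = inversiveCoordinates (W k)

      pull : Vector Carrier 5 → Vector Carrier 5
      pull = pullback mirrors

      π⁻¹ : Fin 8 → Fin 8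
      π⁻¹ = π ⟨$⟩ˡ_

      A : Matrix 5 5
      A = F-matrix W

    f-maps⁻¹ : ∀ a → f maps V (π⁻¹ a) to W a
    f-maps⁻¹ a = ≡.subst (λ b → f maps V (π⁻¹ a) to W b) (inverseʳ π) (f-maps (π⁻¹ a))

    pull-w : ∀ a → pull (w a) ≋ s (π⁻¹ a)
    pull-w a l = trans (maps⇒pullback mirrors f (V (π⁻¹ a)) (W a) f≈ (f-maps⁻¹ a) l) (V≋ (π⁻¹ a) l)

    w-pairing : ∀ a y → ⟪ w a , y ⟫ ≈ ⟪ s (π⁻¹ a) , pull y ⟫
    w-pairing a y = begin
      ⟪ w a , y ⟫                  ≈⟨ pullback-isometry mirrors (w a) y ⟨
      ⟪ pull (w a) , pull y ⟫      ≈⟨ ⟪⟫-cong {w = pull y} (pull-w a) (λ _ → refl) ⟩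
      ⟪ s (π⁻¹ a) , pull y ⟫       ∎

    -- After pulling back, the summands are those of `standard-frame` in permuted order.
    frame : ∀ y z → sum (λ a → ⟪ w a , y ⟫ * ⟪ w a , z ⟫)
          ≈ (1# + 2#) * (⟪ σ , pull y ⟫ * ⟪ σ , pull z ⟫) - 2# * 4# * ⟪ y , z ⟫
    frame y z = begin
      sum (λ a → ⟪ w a , y ⟫ * ⟪ w a , z ⟫)
        ≈⟨ sum-cong-≋ (λ a → *-cong (w-pairing a y) (w-pairing a z)) ⟩
      sum (λ a → ⟪ s (π⁻¹ a) , pull y ⟫ * ⟪ s (π⁻¹ a) , pull z ⟫)
        ≈⟨ sum-permute (λ k → ⟪ s k , pull y ⟫ * ⟪ s k , pull z ⟫) (flip π) ⟨
      sum (λ k → ⟪ s k , pull y ⟫ * ⟪ s k , pull z ⟫)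
        ≈⟨ standard-frame (pull y) (pull z) ⟩
      (1# + 2#) * (⟪ σ , pull y ⟫ * ⟪ σ , pull z ⟫) - 2# * 4# * ⟪ pull y , pull z ⟫
        ≈⟨ +-congˡ (-‿cong (*-congˡ (pullback-isometry mirrors y z))) ⟩
      (1# + 2#) * (⟪ σ , pull y ⟫ * ⟪ σ , pull z ⟫) - 2# * 4# * ⟪ y , z ⟫ ∎

    π⁻¹-injective : ∀ {a b} → π⁻¹ a ≡ π⁻¹ b → a ≡ b
    π⁻¹-injective eq =
      ≡.trans (≡.sym (inverseʳ π)) (≡.trans (≡.cong (π ⟨$⟩ʳ_) eq) (inverseʳ π))

    V-meet : ∀ i j → ¬ Opposite i j → ∃ λ p → surface (V i) p × surface (V j) p
    V-meet i j ¬opposite = tangent⇒meet (V i) (V j) (nonneg i) (nonneg j)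
      (trans (⟪⟫-cong (V≋ i) (V≋ j)) (standard-tangent i j ¬opposite))
      where
      nonneg : ∀ k → 0# ≤ bend (inversiveCoordinates (V k))
      nonneg k with standard-bend-nonneg k
      ... | inj₁ 0<b = inj₁ (<-respʳ-≈ (sym (V≋ k 1F)) 0<b)
      ... | inj₂ 0≈b = inj₂ (trans 0≈b (sym (V≋ k 1F)))

    -- Were the preimages not opposite, they would share a point, and its image under `f` would lie
    -- on both of the disjoint spheres `W a` and `W b`.
    π⁻¹-opposite : ∀ a b → a ≢ b → Opposite a b → Opposite (π⁻¹ a) (π⁻¹ b)
    π⁻¹-opposite a b a≢b a≡b with toℕ (π⁻¹ a) % 4 ℕ.≟ toℕ (π⁻¹ b) % 4
    ... | yes opposite = opposite
    ... | no ¬opposite with p , onᵢ , onⱼ ← V-meet (π⁻¹ a) (π⁻¹ b) ¬opposite =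
      contradiction
        (Equivalence.to (proj₁ (f-maps⁻¹ a p)) onᵢ , Equivalence.to (proj₁ (f-maps⁻¹ b p)) onⱼ)
        (proj₂ (admissible a b a≢b) a≡b (f p))

    -- The right-hand side is the same for every pair: it is entry `l` of the image of `σ` under the
    -- inverse of `pull`, expressed by the adjoint.
    antipodal-sum : ∀ a b → a ≢ b → Opposite a b → ∀ l → w a l + w b l ≈ ⟪ σ , pull (dual l) ⟫
    antipodal-sum a b a≢b a≡b l = begin
      w a l + w b l
        ≈⟨ +-cong (dual-pairing (w a) l) (dual-pairing (w b) l) ⟨
      ⟪ w a , dual l ⟫ + ⟪ w b , dual l ⟫
        ≈⟨ +-cong (w-pairing a (dual l)) (w-pairing b (dual l)) ⟩
      ⟪ sₐ , y ⟫ + ⟪ s_b , y ⟫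
        ≈⟨ +-cong (⟪⟫-comm sₐ y) (trans (⟪⟫-comm s_b y) (sym (*-identityˡ _))) ⟩
      ⟪ y , sₐ ⟫ + 1# * ⟪ y , s_b ⟫
        ≈⟨ ⟪⟫-linearʳ y sₐ 1# s_b ⟨
      ⟪ y , (λ i → sₐ i + 1# * s_b i) ⟫
        ≈⟨ ⟪⟫-cong {y} (λ _ → refl) (standard-antipodal (π⁻¹ a) (π⁻¹ b)
             (a≢b ∘ π⁻¹-injective) (π⁻¹-opposite a b a≢b a≡b)) ⟩
      ⟪ y , σ ⟫
        ≈⟨ ⟪⟫-comm y σ ⟩
      ⟪ σ , y ⟫ ∎
      where
      y = pull (dual l)
      sₐ = s (π⁻¹ a)
      s_b = s (π⁻¹ b)

    twice-μ : ∀ l → 2# * A 4F l ≈ ⟪ σ , pull (dual l) ⟫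
    twice-μ l = begin
      2# * (½ * (w 0F l + w 4F l))    ≈⟨ *-assoc 2# ½ _ ⟨
      2# * ½ * (w 0F l + w 4F l)      ≈⟨ *-congʳ ½-inverse ⟩
      1# * (w 0F l + w 4F l)          ≈⟨ *-identityˡ _ ⟩
      w 0F l + w 4F l                 ≈⟨ antipodal-sum 0F 4F (λ ()) ≡.refl l ⟩
      ⟪ σ , pull (dual l) ⟫           ∎

    opposite≈ : ∀ a b → a ≢ b → Opposite a b → ∀ l → 2# * A 4F l - w a l ≈ w b l
    opposite≈ a b a≢b a≡b l = begin
      2# * A 4F l - w a l        ≈⟨ +-congʳ (trans (twice-μ l) (sym (antipodal-sum a b a≢b a≡b l))) ⟩
      w a l + w b l - w a l      ≈⟨ solve 2 (λ x y → x :+ y :- x := y) (w a l) (w b l) ⟩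
      w b l                      ∎

    -- Matches the eight entries of `frame-entry` with the pairings summed in `frame`: `2 μ - vₖ` is
    -- the vector of the sphere opposite to the k-th.
    w≋ : ∀ l → (A 0F l ∷ A 1F l ∷ A 2F l ∷ A 3F l ∷ 2# * A 4F l - A 0F l ∷ 2# * A 4F l - A 1F l
                ∷ 2# * A 4F l - A 2F l ∷ 2# * A 4F l - A 3F l ∷ [])
             ≋ (λ k → ⟪ w k , dual l ⟫)
    w≋ l k = trans (rows k) (sym (dual-pairing (w k) l))
      where
      rows : (A 0F l ∷ A 1F l ∷ A 2F l ∷ A 3F l ∷ 2# * A 4F l - A 0F l ∷ 2# * A 4F l - A 1F l
              ∷ 2# * A 4F l - A 2F l ∷ 2# * A 4F l - A 3F l ∷ []) ≋ (λ k → w k l)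
      rows 0F = refl
      rows 1F = refl
      rows 2F = refl
      rows 3F = refl
      rows 4F = opposite≈ 0F 4F (λ ()) ≡.refl l
      rows 5F = opposite≈ 1F 5F (λ ()) ≡.refl l
      rows 6F = opposite≈ 2F 6F (λ ()) ≡.refl l
      rows 7F = opposite≈ 3F 7F (λ ()) ≡.refl l

    -- Evaluating `frame` at `dual i` and `dual j` reads off one matrix entry; the two multiples of
    -- `τ i * τ j` cancel.
    F-matrix-identity : A ᵀ ⊗ Q-F ⊗ A ≈ᴹ Q-W
    F-matrix-identity i j = *-cancelˡ 2≉0 (begin
      2# * (A ᵀ ⊗ Q-F ⊗ A) i j
        ≈⟨ frame-entry A i j ⟩
      _ - (1# + 2#) * (2# * A 4F i * (2# * A 4F j))
        ≈⟨ +-cong (sum-cong-≋ (λ k → *-cong (w≋ i k) (w≋ j k)))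
                  (-‿cong (*-congˡ (*-cong (twice-μ i) (twice-μ j)))) ⟩
      sum (λ k → ⟪ w k , dual i ⟫ * ⟪ w k , dual j ⟫) - (1# + 2#) * (τ i * τ j)
        ≈⟨ +-congʳ (frame (dual i) (dual j)) ⟩
      (1# + 2#) * (τ i * τ j) - 2# * 4# * ⟪ dual i , dual j ⟫ - (1# + 2#) * (τ i * τ j)
        ≈⟨ +-congʳ (+-congˡ (-‿cong (*-congˡ
             (dual-pairing (dual i) j)))) ⟩
      (1# + 2#) * (τ i * τ j) - 2# * 4# * (- (½ * ½) * Q-W i j) - (1# + 2#) * (τ i * τ j)
        -- What remains is `- 8` times `- 1/4` of the entry of `Q-W`, that is twice that entry; the
        -- cofactor is again a difference of squares.
        ≈⟨ modulo (2# * Q-W i j * (2# * ½ + 1#)) ½-inverse (solve 3 (λ t h q →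
             t :- :2 :* :4 :* (:- (h :* h) :* q) :- t
               := :2 :* q :+ :2 :* q :* (:2 :* h :+ :1) :* (:2 :* h :- :1))
             ((1# + 2#) * (τ i * τ j)) ½ (Q-W i j)) ⟩
      2# * Q-W i j ∎)
      where
      τ : Fin 5 → Carrier
      τ l = ⟪ σ , pull (dual l) ⟫

theorem3p8 : ∀ {c ℓ₁ ℓ₂} (ℝ : Reals c ℓ₁ ℓ₂) →
    let open Reals ℝ
        open Orthoplicial ℝ
    in (W : Vector OrientedSphere 8) → IsOrthoplicial W → IsAdmissible W →
      (F-matrix W ᵀ ⊗ Q-F ⊗ F-matrix W ≈ᴹ Q-W)
      × (descartesForm (column (F-matrix W) 0F) ≈ 0#)
      × (descartesForm (column (F-matrix W) 1F) ≈ 0#)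
      × (descartesForm (column (F-matrix W) 2F) ≈ 2#)
      × (descartesForm (column (F-matrix W) 3F) ≈ 2#)
      × (descartesForm (column (F-matrix W) 4F) ≈ 2#)
theorem3p8 ℝ W (V , f , π , (√2 , _ , √2-square , V≋) , (mirrors , f≈) , f-maps) admissible =
  identity , diagonal 0F , diagonal 1F , diagonal 2F , diagonal 3F , diagonal 4F
  where
  open Reals ℝ using (_≈_; trans)
  open Orthoplicial ℝ
  open OrthoplicialConfiguration ℝ

  identity : F-matrix W ᵀ ⊗ Q-F ⊗ F-matrix W ≈ᴹ Q-W
  identity = Admissible.F-matrix-identity
    W admissible V f π √2 √2-square V≋ mirrors f≈ f-maps

  -- At each concrete index the diagonal entry of `Q-W` computes to the required 0 or 2.
  diagonal : ∀ i → descartesForm (column (F-matrix W) i) ≈ Q-W i i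
  diagonal i = trans (descartesForm-entry (F-matrix W) i) (identity i i)
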